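{- For every finite graph $G$ (with at least one vertex) we have $\operatorname{pn}_\ell(G) \leq \operatorname{sa}_\ell(G)$ and $\operatorname{pn}_u(G) \leq \operatorname{sa}(G)$. In particular, \[ \frac{\operatorname{mad}(G)}{4} \leq \operatorname{pn}_\ell(G) \leq \frac{\operatorname{mad}(G)}{2}+2 \quad\text{and}\quad \frac{\operatorname{mad}(G)}{4} \leq \operatorname{pn}_u(G) \leq \operatorname{mad}(G)+2. \]
   Context: All graphs are finite and simple. A linear embedding of a graph $G=(V,E)$ is a pair $(\prec,\mathcal{P})$ where $\prec$ is a total order on $V$ and $\mathcal{P}$ is a partition of $E$ into parts called pages. Two edges $uv, xy$ with $u\prec v$, $x \prec y$ cross if $u \prec x \prec v \prec y$ or $x \prec u \prec y \prec v$. A linear embedding is a book embedding if no two crossing edges lie in the same page. For a book embedding and a vertex $v$, let $\mathcal{P}_v$ be the set of pages containing at least one edge incident to $v$; the embedding is $k$-local if $|\mathcal{P}_v|\le k$ for all $v$, and the local page number $\operatorname{pn}_\ell(G)$ is the least $k$ such that $G$ has a $k$-local book embedding (with any number of pages). For a page $P$, let $G_P$ be the subgraph consisting of the edges of $P$ and all vertices incident to an edge of $P$. A linear embedding is a union embedding if for every page $P$ and every connected component $C$ of $G_P$, no two edges of $C$ cross; the union page number $\operatorname{pn}_u(G)$ is the minimum number of pages in a union embedding of $G$. The maximum average degree is $\operatorname{mad}(G)=\max\{2|E(H)|/|V(H)| : H\subseteq G, H\neq\emptyset\}$. A star forest is a graph each of whose components is a star $K_{1,m}$. The star arboricity $\operatorname{sa}(G)$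 is the minimum number of star forests into which $E(G)$ can be partitioned. The local star arboricity $\operatorname{sa}_\ell(G)$ is the minimum $k$ such that $E(G)$ can be partitioned into (any number of) stars with each vertex of $G$ incident to edges of at most $k$ of these stars. -}

module Defs where

open import Data.Nat as ℕ using (ℕ; _⊓_; _⊔_; NonZero)
open import Data.Fin using (Fin; toℕ)
open import Data.Fin.Subset using (Subset; _∈_; ∣_∣)
open import Data.Fin.Properties using (any?)
open import Data.Vec using (tabulate)
open import Data.Bool using (Bool)
open import Data.Product using (Σ; ∃; _×_; _,_)
open import Data.Sum using (_⊎_)
open import Data.Integer using (+_)
open import Data.Rational as ℚ using (ℚ)
open import Relation.Binary.PropositionalEquality using (_≡_)
open import Relation.Nullary using (¬_; Dec; does)
open import Relation.Nullary.Decidable using (_×-dec_; _⊎-dec_)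
open import Function.Definitions using (Injective)
import Data.Fin as F

-- Finite simple graphs: vertices Fin n, edges Fin m, edge e joins
-- src e and tgt e with src e < tgt e (no loops), and no two edges
-- have the same endpoints (no multi-edges).

record Graph : Set where
  field
    n m    : ℕ
    src    : Fin m → Fin n
    tgt    : Fin m → Fin n
    src<tgt : ∀ e → src e F.< tgt e
    simple : ∀ e f → src e ≡ src f → tgt e ≡ tgt f → e ≡ f

module _ (G : Graph) where
  open Graph G

  Incident : Fin m → Fin n → Set
  Incident e v = (src e ≡ v) ⊎ (tgt e ≡ v)

  ShareEnd : Fin m → Fin m → Set
  ShareEnd e f = Σ (Fin n) λ v → Incident e v × Incident f v

  -- Given a labelling of the edges (pages / stars / star forests),
  -- Conn lab e f : e and f lie in the same connected component of the
  -- subgraph formed by the edges with label lab e.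
  data Conn {p : ℕ} (lab : Fin m → Fin p) (e : Fin m) : Fin m → Set where
    here : Conn lab e e
    step : ∀ {f g} → Conn lab e f → lab g ≡ lab f → ShareEnd f g → Conn lab e g

  LabelsAt : {p : ℕ} → (Fin m → Fin p) → Fin n → Subset p
  LabelsAt lab v = tabulate λ i →
    does (any? λ e → ((src e F.≟ v) ⊎-dec (tgt e F.≟ v)) ×-dec (lab e F.≟ i))

  -- A total order on V is given by an injective position map pos;
  -- u ≺ v iff pos u < pos v.
  module _ (pos : Fin n → Fin n) where
    lo hi : Fin m → ℕ
    lo e = toℕ (pos (src e)) ⊓ toℕ (pos (tgt e))
    hi e = toℕ (pos (src e)) ⊔ toℕ (pos (tgt e))

    Cross : Fin m → Fin m → Set
    Cross e f = (lo e ℕ.< lo f × lo f ℕ.< hi e × hi e ℕ.< hi f)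
              ⊎ (lo f ℕ.< lo e × lo e ℕ.< hi f × hi f ℕ.< hi e)

  IsBook : (pos : Fin n → Fin n) {p : ℕ} → (Fin m → Fin p) → Set
  IsBook pos page = ∀ e f → page e ≡ page f → ¬ Cross pos e f

  IsUnion : (pos : Fin n → Fin n) {p : ℕ} → (Fin m → Fin p) → Set
  IsUnion pos page = ∀ e f → Conn page e f → ¬ Cross pos e f

  HasLocalBook : ℕ → Set
  HasLocalBook k = Σ (Fin n → Fin n) λ pos → Injective _≡_ _≡_ pos ×
    Σ ℕ λ p → Σ (Fin m → Fin p) λ page →
      IsBook pos page × (∀ v → ∣ LabelsAt page v ∣ ℕ.≤ k)

  HasUnion : ℕ → Set
  HasUnion p = Σ (Fin n → Fin n) λ pos → Injective _≡_ _≡_ pos ×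
    Σ (Fin m → Fin p) λ page → IsUnion pos page

  HasLocalStar : ℕ → Set
  HasLocalStar k = Σ ℕ λ q → Σ (Fin m → Fin q) λ star →
    Σ (Fin q → Fin n) λ centre →
      (∀ e → Incident e (centre (star e))) ×
      (∀ v → ∣ LabelsAt star v ∣ ℕ.≤ k)

  -- E(G) partitioned into q star forests: every connected component
  -- of each class is a star (all its edges go through a common centre)
  HasStarForests : ℕ → Set
  HasStarForests q = Σ (Fin m → Fin q) λ cls →
    ∀ e → Σ (Fin n) λ c → ∀ f → Conn cls e f → Incident f c

  IsLeast : (ℕ → Set) → ℕ → Set
  IsLeast P k = P k × (∀ j → P j → k ℕ.≤ j)

  IsPnℓ IsPnu IsSaℓ IsSa : ℕ → Set
  IsPnℓ = IsLeast HasLocalBook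
  IsPnu = IsLeast HasUnion
  IsSaℓ = IsLeast HasLocalStar
  IsSa  = IsLeast HasStarForests

  IsSubgraph : Subset n → Subset m → Set
  IsSubgraph S Fs = ∀ e → e ∈ Fs → src e ∈ S × tgt e ∈ S

  density : (S : Subset n) → Subset m → NonZero ∣ S ∣ → ℚ
  density S Fs nz = ℚ._/_ (+ (2 ℕ.* ∣ Fs ∣)) ∣ S ∣ {{nz}}

  IsMad : ℚ → Set
  IsMad q =
    (∀ S Fs → IsSubgraph S Fs → (nz : NonZero ∣ S ∣) → density S Fs nz ℚ.≤ q) ×
    (Σ (Subset n) λ S → Σ (Subset m) λ Fs → IsSubgraph S Fs ×
       Σ (NonZero ∣ S ∣) λ nz → density S Fs nz ≡ q)

ℕtoℚ : ℕ → ℚ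
ℕtoℚ k = ℚ._/_ (+ k) 1

{-# OPTIONS --safe #-}
module Submission where

open import Defs
open import Data.Nat using (ℕ; _≤_)
open import Data.Product using (_×_)
open import Data.Integer using (+_)
open import Data.Rational using (ℚ; _/_; _*_; _+_) renaming (_≤_ to _≤ℚ_)

open import Data.Bool using (Bool; true; false; not)
open import Data.Bool.Properties using (not-¬)
open import Data.Fin using (Fin; zero; suc; toℕ; fromℕ<; punchIn; punchOut; combine; remQuot; inject≤)
open import Data.Fin.Properties
  using (_≟_; any?; all?; toℕ-injective; toℕ-fromℕ<; suc-injective; <-asym; <-irrefl;
         punchIn-injective; punchIn-punchOut; punchOut-injective; inject≤-injective;
         combine-injective; combine-remQuot; injective⇒≤)
open import Data.Fin.Subset using (Subset; _∈_; _∉_; _⊆_; _⊂_; _∪_; _─_; _-_; ⁅_⁆; ⊥; ⊤; ∣_∣)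
open import Data.Fin.Subset.Induction using (⊂-wellFounded; ⊃-wellFounded)
open import Data.Fin.Subset.Properties
import Data.Integer as ℤ
import Data.Integer.Properties as ℤₚ
open import Data.Maybe as Maybe using (Maybe; just; nothing)
open import Data.Maybe.Properties using (just-injective; ≡-dec)
open import Data.Nat as ℕ using (zero; suc; _<_; _⊔_; _⊓_; z≤n; s≤s; NonZero)
import Data.Nat.DivMod as DivMod
open import Data.Nat.Induction using (<-rec)
import Data.Nat.Properties as ℕₚ
open import Data.Nat.Tactic.RingSolver using (solve-∀)
open import Data.Product using (∃-syntax; _,_; proj₁; proj₂)
open import Data.Product.Properties using () renaming (≡-dec to ×-≡-dec)
import Data.Rational as ℚ
import Data.Rational.Properties as ℚₚ
open import Data.Rational.Unnormalised using (mkℚᵘ; *≤*) renaming (_≤_ to _≤ᵘ_; _≃_ to _≃ᵘ_)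
import Data.Rational.Unnormalised.Properties as ℚᵘₚ
open import Data.Sum using (_⊎_; inj₁; inj₂; [_,_]′; swap)
import Data.Unit as Unit
open import Data.Vec using ([]; _∷_; here; there; tabulate)
open import Data.Vec.Functional using (updateAt)
open import Data.Vec.Functional.Properties using (updateAt-updates; updateAt-minimal)
open import Data.Vec.Properties using (lookup∘tabulate; []=⇒lookup; lookup⇒[]=)
open import Function using (_∘_; const; id)
open import Function.Definitions using (Injective)
open import Induction.WellFounded using (Acc; acc)
open import Relation.Binary.Definitions using (tri<; tri≈; tri>)
open import Relation.Binary.PropositionalEquality
open import Relation.Nullary using (¬_; Dec; yes; no; contradiction; does)
open import Relation.Nullary.Decidable
  using (_×-dec_; _⊎-dec_; _→-dec_; ¬?; decidable-stable; dec-true)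
open import Relation.Unary using (Decidable)

-- Lower bounds. On a crossing-free page, charge every edge to its lower end if it is the
-- longest edge going up from there, and to its upper end otherwise; each vertex is charged
-- at most twice by each page it meets.
--
-- Upper bounds. With p = ⌊mad / 2⌋ + 1, augmenting paths orient G with out-degree at most p.
-- The in-stars of this orientation show that the local star arboricity is at most p + 1.
-- For the union page number, the out-arcs decompose into p forests and one galaxy (Amini,
-- Havet, Huc and Thomassé, "WDM and directed star arboricity"). One of the forests is drawn
-- on a single page by a suitable vertex order, each of the others splits into two star
-- forests, and the galaxy is a star forest: 2 p pages in all.

-- When mad / 2 is an integer, the bound mad + 2 equals 2 p, whereas two pages for each of the p
-- forests and one for the galaxy would make 2 p + 1. The missing page is saved by the vertex order:
-- star forests have no crossings inside a component whatever the order, so the order is free to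
-- serve one forest, which then fits on one page instead of two.
--
-- Bounded out-degree alone would split the arcs, slot by slot, into functional graphs. These may
-- contain odd cycles, which defeat the 2-colouring that turns a forest into two star forests. The
-- galaxy is there to absorb arcs until the rest can be relabelled into acyclic classes.

private variable
  n m p : ℕ
  A : Set

-- Finite maps and finite subsets

sup : (Fin n → ℕ) → ℕ
sup {zero}  f = 0
sup {suc n} f = f zero ⊔ sup (f ∘ suc)

≤sup : (f : Fin n → ℕ) → ∀ v → f v ≤ sup f
≤sup f zero    = ℕₚ.m≤m⊔n _ _
≤sup f (suc v) = ℕₚ.≤-trans (≤sup (f ∘ suc) v) (ℕₚ.m≤n⊔m (f zero) _)

_[_≔_] : (Fin n → A) → Fin n → A → Fin n → A
f [ x ≔ a ] = updateAt f x (const a)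

≔-same : (f : Fin n → A) (x : Fin n) {a : A} → (f [ x ≔ a ]) x ≡ a
≔-same f x = updateAt-updates x f

≔-other : (f : Fin n → A) {x y : Fin n} {a : A} → y ≢ x → (f [ x ≔ a ]) y ≡ f y
≔-other f {x} {y} y≢x = updateAt-minimal y x f y≢x

⊂-insert : ∀ {S : Subset n} {x} → x ∉ S → S ⊂ S ∪ ⁅ x ⁆
⊂-insert {S = S} {x} x∉S = p⊆p∪q ⁅ x ⁆ , x , q⊆p∪q S ⁅ x ⁆ (x∈⁅x⁆ x) , x∉S

∈-insert⁻ : ∀ {S : Subset n} {x y} → y ∈ S ∪ ⁅ x ⁆ → y ≢ x → y ∈ S
∈-insert⁻ {S = S} {x} y∈ y≢x with x∈p∪q⁻ S ⁅ x ⁆ y∈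
... | inj₁ y∈S = y∈S
... | inj₂ y∈x = contradiction (x∈⁅y⁆⇒x≡y x y∈x) y≢x

∈-insert-new : ∀ {S : Subset n} {x} → x ∈ S ∪ ⁅ x ⁆
∈-insert-new {S = S} {x} = q⊆p∪q S ⁅ x ⁆ (x∈⁅x⁆ x)

∈-insert-old : ∀ {S : Subset n} {x y} → y ∈ S → y ∈ S ∪ ⁅ x ⁆
∈-insert-old {x = x} = p⊆p∪q ⁅ x ⁆

∈─⁻ : ∀ (S T : Subset n) {x} → x ∈ S ─ T → x ∉ T
∈─⁻ (s ∷ S) (_ ∷ T) ()         here
∈─⁻ (s ∷ S) (_ ∷ T) (there x∈) (there x∈T) = ∈─⁻ S T x∈ x∈T

⁅⁆⊆ : ∀ {S : Subset n} {x} → x ∈ S → ⁅ x ⁆ ⊆ S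
⁅⁆⊆ {S = S} {x} x∈S y∈ = subst (_∈ S) (sym (x∈⁅y⁆⇒x≡y x y∈)) x∈S

-- Proper supersets are well-founded on a finite set. In-trees, orders of forest vertices,
-- alternating paths and matchings are all built by this one search: the current set either settles
-- the goal or admits one more element.
grow : {P : Subset n → Set} {C : Set} →
       (∀ S → P S → C ⊎ (∃[ x ] x ∉ S × P (S ∪ ⁅ x ⁆))) →
       ∀ S → P S → C
grow {P = P} {C} extend S = go S (⊃-wellFounded S)
  where
  go : ∀ S → Acc _ S → P S → C
  go S (acc rec) PS with extend S PS
  ... | inj₁ c = c
  ... | inj₂ (x , x∉S , PS′) = go _ (rec (⊂-insert x∉S)) PS′

-- Decomposition of digraphs into forests and a galaxy

-- A digraph of out-degree at most p: nb v i is the head of the arc in slot i at v, if any.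
Arcs : ℕ → ℕ → Set
Arcs n p = Fin n → Fin p → Maybe (Fin n)

record Simple (nb : Arcs n p) : Set where
  field
    no-loop     : ∀ v i → nb v i ≢ just v
    no-parallel : ∀ {v i j w} → nb v i ≡ just w → nb v j ≡ just w → i ≡ j

-- A partition of the arcs with tail in V into p functional forests, labelled just c,
-- and a galaxy, labelled nothing. Forests are certified by ranks that decrease along
-- the arcs inside V. That u is not the tail of a galaxy arc makes it possible to add an
-- arc to u to the galaxy in the induction.
record Decomposition (nb : Arcs n p) (V : Subset n) (u : Fin n) : Set where
  field
    lab     : Fin n → Fin p → Maybe (Fin p)
    rank    : Fin p → Fin n → ℕ
    lab-inj : ∀ {v i j} → v ∈ V → lab v i ≡ lab v j → i ≡ j
    descend : ∀ {v i w c} → v ∈ V → w ∈ V → nb v i ≡ just w → lab v i ≡ just c →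
              rank c w < rank c v
    galaxy  : ∀ {v i} → v ∈ V → lab v i ≡ nothing →
              ∃[ w ] nb v i ≡ just w × w ∈ V × (∀ j → lab w j ≢ nothing)
    avoids  : u ∈ V → ∀ i → lab u i ≢ nothing

arcless-decomposition : ∀ {nb : Arcs n p} {V} {u} →
  (∀ {v i w} → v ∈ V → w ∈ V → nb v i ≢ just w) → Decomposition nb V u
arcless-decomposition arcless = record
  { lab     = λ _ → just
  ; rank    = λ _ _ → 0
  ; lab-inj = λ _ → just-injective
  ; descend = λ v∈V w∈V e _ → contradiction e (arcless v∈V w∈V)
  ; galaxy  = λ _ ()
  ; avoids  = λ _ _ ()
  }

module _ {nb : Arcs n p} {V : Subset n} {u : Fin n} where

  -- Arcs between the two sides only leave `S`. Lifting all ranks on `S` above those of the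
  -- complement makes these arcs descend, whatever forest they are in. Galaxy arcs stay within their
  -- side, so the condition on their heads is inherited.
  glue : ∀ {S} → S ⊆ V →
         (∀ {v i w} → v ∈ V ─ S → w ∈ S → nb v i ≢ just w) →
         Decomposition nb S u → Decomposition nb (V ─ S) u → Decomposition nb V u
  glue {S} S⊆V closed DS DT = record
    { lab = lab ; rank = rank ; lab-inj = lab-inj ; descend = descend
    ; galaxy = galaxy ; avoids = avoids }
    where
    module DS = Decomposition DS
    module DT = Decomposition DT

    side : ∀ {v} → v ∈ V → v ∉ S → v ∈ V ─ S
    side = x∈p∧x∉q⇒x∈p─q

    lab : Fin n → Fin p → Maybe (Fin p)
    lab v with v ∈? S
    ... | yes _ = DS.lab v
    ... | no  _ = DT.lab v

    rank : Fin p → Fin n → ℕ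
    rank c v with v ∈? S
    ... | yes _ = suc (sup (DT.rank c)) ℕ.+ DS.rank c v
    ... | no  _ = DT.rank c v

    lab-inj : ∀ {v i j} → v ∈ V → lab v i ≡ lab v j → i ≡ j
    lab-inj {v} v∈V eq with v ∈? S
    ... | yes v∈S = DS.lab-inj v∈S eq
    ... | no  v∉S = DT.lab-inj (side v∈V v∉S) eq

    descend : ∀ {v i w c} → v ∈ V → w ∈ V → nb v i ≡ just w → lab v i ≡ just c →
              rank c w < rank c v
    descend {v} {i} {w} {c} v∈V w∈V e l with v ∈? S | w ∈? S
    ... | yes v∈S | yes w∈S = ℕₚ.+-monoʳ-< (suc (sup (DT.rank c))) (DS.descend v∈S w∈S e l)
    ... | yes v∈S | no  w∉S = s≤s (ℕₚ.≤-trans (≤sup (DT.rank c) w) (ℕₚ.m≤m+n _ _))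
    ... | no  v∉S | yes w∈S = contradiction e (closed (side v∈V v∉S) w∈S)
    ... | no  v∉S | no  w∉S = DT.descend (side v∈V v∉S) (side w∈V w∉S) e l

    lab-S : ∀ {v} → v ∈ S → lab v ≡ DS.lab v
    lab-S {v} v∈S with v ∈? S
    ... | yes _   = refl
    ... | no  v∉S = contradiction v∈S v∉S

    lab-T : ∀ {v} → v ∈ V ─ S → lab v ≡ DT.lab v
    lab-T {v} v∈T with v ∈? S
    ... | yes v∈S = contradiction v∈S (∈─⁻ V S v∈T)
    ... | no  _   = refl

    galaxy : ∀ {v i} → v ∈ V → lab v i ≡ nothing →
             ∃[ w ] nb v i ≡ just w × w ∈ V × (∀ j → lab w j ≢ nothing)
    galaxy {v} v∈V l with v ∈? S
    ... | yes v∈S = let w , e , w∈S , ok = DS.galaxy v∈S l in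
      w , e , S⊆V w∈S , λ j → subst (_≢ nothing) (sym (cong-app (lab-S w∈S) j)) (ok j)
    ... | no  v∉S = let w , e , w∈T , ok = DT.galaxy (side v∈V v∉S) l in
      w , e , p─q⊆p V S w∈T , λ j → subst (_≢ nothing) (sym (cong-app (lab-T w∈T) j)) (ok j)

    avoids : u ∈ V → ∀ i → lab u i ≢ nothing
    avoids u∈V i with u ∈? S
    ... | yes u∈S = DS.avoids u∈S i
    ... | no  u∉S = DT.avoids (side u∈V u∉S) i

-- An in-tree on S with root v whose arc at x ≢ v occupies the slot t x, and which
-- contains every arc from S to v.
record InTree (nb : Arcs n p) (v : Fin n) (S : Subset n) : Set where
  field
    t        : Fin n → Fin p
    height   : Fin n → ℕ
    descends : ∀ {x} → x ∈ S → x ≢ v → ∃[ w ] nb x (t x) ≡ just w × w ∈ S × height w < height x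
    to-root  : ∀ {x i} → x ∈ S → x ≢ v → nb x i ≡ just v → i ≡ t x

-- The tree is a new forest, v → u joins the galaxy, and the other arcs leaving v go to
-- distinct old forests: they close no cycles there, because all arcs to v are in the tree.
module ExtendByTree {nb : Arcs n (suc p)} (simple : Simple nb) {V : Subset n} {u v : Fin n}
                    (u∈V : u ∈ V) (v∈V : v ∈ V) {i₀ : Fin (suc p)} (v→u : nb v i₀ ≡ just u)
                    (tree : InTree nb v V) where

  open Simple simple
  open InTree tree

  u≢v : u ≢ v
  u≢v refl = no-loop v i₀ v→u

  -- The one slot per vertex that is taken out: the tree arc, or at `v` the arc to `u`. What remains
  -- has one slot fewer, so the induction hypothesis yields only `p` forests and leaves a label for
  -- the tree.
  d : Fin n → Fin (suc p)
  d = t [ v ≔ i₀ ]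

  nb-rest : Arcs n p
  nb-rest x j = nb x (punchIn (d x) j)

  rest-simple : Simple nb-rest
  rest-simple = record
    { no-loop     = λ x j → no-loop x (punchIn (d x) j)
    ; no-parallel = λ {x} e e′ → punchIn-injective (d x) _ _ (no-parallel e e′)
    }

  module _ (D : Decomposition nb-rest (V - v) u) where
    module D = Decomposition D

    shift : Maybe (Fin p) → Maybe (Fin (suc p))
    shift = Maybe.map suc

    lab-d : Fin n → Maybe (Fin (suc p))
    lab-d x with x ≟ v
    ... | yes _ = nothing
    ... | no  _ = just zero

    lab-rest : Fin n → Fin p → Maybe (Fin (suc p))
    lab-rest x j with x ≟ v
    ... | yes _ = just (suc j)
    ... | no  _ = shift (D.lab x j)

    lab₊ : Fin n → Fin (suc p) → Maybe (Fin (suc p))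
    lab₊ x i with d x ≟ i
    ... | yes _   = lab-d x
    ... | no  d≢i = lab-rest x (punchOut d≢i)

    rank₊ : Fin (suc p) → Fin n → ℕ
    rank₊ zero    x = height x
    rank₊ (suc c) x with x ≟ v
    ... | yes _ = suc (sup (D.rank c))
    ... | no  _ = D.rank c x

    keep : ∀ {x} → x ∈ V → x ≢ v → x ∈ V - v
    keep = x∈p∧x≢y⇒x∈p-y

    d-v : d v ≡ i₀
    d-v = ≔-same t v

    d-t : ∀ {x} → x ≢ v → d x ≡ t x
    d-t = ≔-other t

    shift-inj : ∀ a b → shift a ≡ shift b → a ≡ b
    shift-inj (just _) (just _) eq = cong just (suc-injective (just-injective eq))
    shift-inj nothing  nothing  eq = refl

    d≢rest : ∀ x j → lab-d x ≢ lab-rest x j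
    d≢rest x j eq with x ≟ v
    d≢rest x j () | yes _
    ... | no _ with D.lab x j
    d≢rest x j () | no _ | just _
    d≢rest x j () | no _ | nothing

    rest-inj : ∀ {x j k} → x ∈ V → lab-rest x j ≡ lab-rest x k → j ≡ k
    rest-inj {x} x∈V eq with x ≟ v
    ... | yes _   = suc-injective (just-injective eq)
    ... | no  x≢v = D.lab-inj (keep x∈V x≢v) (shift-inj _ _ eq)

    lab₊-inj : ∀ {x i j} → x ∈ V → lab₊ x i ≡ lab₊ x j → i ≡ j
    lab₊-inj {x} {i} {j} x∈V eq with d x ≟ i | d x ≟ j
    ... | yes d≡i | yes d≡j = trans (sym d≡i) d≡j
    ... | yes _   | no  _   = contradiction eq (d≢rest x _)
    ... | no  _   | yes _   = contradiction (sym eq) (d≢rest x _)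
    ... | no  d≢i | no  d≢j = punchOut-injective d≢i d≢j (rest-inj x∈V eq)

    nb-rest-punchOut : ∀ {x i w} (d≢i : d x ≢ i) → nb x i ≡ just w → nb-rest x (punchOut d≢i) ≡ just w
    nb-rest-punchOut {x} d≢i e = trans (cong (nb x) (punchIn-punchOut d≢i)) e

    not-root : ∀ {x i w} → x ∈ V → x ≢ v → d x ≢ i → nb x i ≡ just w → w ≢ v
    not-root x∈V x≢v d≢i e refl =
      d≢i (trans (d-t x≢v) (sym (to-root x∈V x≢v e)))

    rank₊-other : ∀ {x} c → x ≢ v → rank₊ (suc c) x ≡ D.rank c x
    rank₊-other {x} c x≢v with x ≟ v
    ... | yes x≡v = contradiction x≡v x≢v
    ... | no  _   = refl

    rank₊-v : ∀ c → rank₊ (suc c) v ≡ suc (sup (D.rank c))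
    rank₊-v c with v ≟ v
    ... | yes _   = refl
    ... | no  v≢v = contradiction refl v≢v

    shift-just : ∀ {a c} → shift a ≡ just c → ∃[ c′ ] a ≡ just c′ × c ≡ suc c′
    shift-just {just c′} refl = c′ , refl , refl

    shift-nothing : ∀ {a} → shift a ≡ nothing → a ≡ nothing
    shift-nothing {nothing} _ = refl

    descend₊ : ∀ {x i w c} → x ∈ V → w ∈ V → nb x i ≡ just w → lab₊ x i ≡ just c →
               rank₊ c w < rank₊ c x
    descend₊ {x} {i} {w} x∈V w∈V e l with d x ≟ i
    ... | yes refl with x ≟ v
    descend₊ {x} {i} {w} x∈V w∈V e refl | yes refl | no x≢v
      with w′ , e′ , _ , lt ← descends x∈V x≢v
      with refl ← trans (sym e) (trans (cong (nb x) (d-t x≢v)) e′) = lt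
    descend₊ {x} {i} {w} x∈V w∈V e l | no d≢i with x ≟ v
    descend₊ {x} {i} {w} x∈V w∈V e refl | no d≢i | yes refl =
      subst₂ _<_ (sym (rank₊-other c w≢v)) (sym (rank₊-v c)) (s≤s (≤sup (D.rank c) w))
      where
      c = punchOut d≢i
      w≢v : w ≢ v
      w≢v refl = no-loop v i e
    ... | no x≢v
      with c′ , l′ , refl ← shift-just {D.lab x (punchOut d≢i)} l =
      subst₂ _<_ (sym (rank₊-other c′ w≢v)) (sym (rank₊-other c′ x≢v))
        (D.descend (keep x∈V x≢v) (keep w∈V w≢v) (nb-rest-punchOut d≢i e) l′)
      where
      w≢v = not-root x∈V x≢v d≢i e

    not-tail : ∀ {w} → w ≢ v → (∀ j → D.lab w j ≢ nothing) → ∀ i → lab₊ w i ≢ nothing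
    not-tail {w} w≢v ok i l with d w ≟ i
    ... | yes _ with w ≟ v
    ...   | yes w≡v = w≢v w≡v
    not-tail {w} w≢v ok i l | no d≢i with w ≟ v
    ...   | yes w≡v = w≢v w≡v
    ...   | no  _   = ok _ (shift-nothing l)

    galaxy₊ : ∀ {x i} → x ∈ V → lab₊ x i ≡ nothing →
              ∃[ w ] nb x i ≡ just w × w ∈ V × (∀ j → lab₊ w j ≢ nothing)
    galaxy₊ {x} {i} x∈V l with d x ≟ i
    ... | yes refl with x ≟ v
    ...   | yes refl =
      u , trans (cong (nb v) d-v) v→u , u∈V , not-tail u≢v (D.avoids (keep u∈V u≢v))
    galaxy₊ {x} {i} x∈V l | no d≢i with x ≟ v
    ...   | no x≢v
      with w , e , w∈ , ok ← D.galaxy (keep x∈V x≢v) (shift-nothing l) =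
      w , e′ , p─q⊆p V ⁅ v ⁆ w∈ , not-tail (not-root x∈V x≢v d≢i e′) ok
      where
      e′ = trans (cong (nb x) (sym (punchIn-punchOut d≢i))) e

    extend-by-tree : Decomposition nb V u
    extend-by-tree = record
      { lab     = lab₊
      ; rank    = rank₊
      ; lab-inj = lab₊-inj
      ; descend = descend₊
      ; galaxy  = galaxy₊
      ; avoids  = λ _ → not-tail u≢v (D.avoids (keep u∈V u≢v))
      }

module _ {nb : Arcs n p} (simple : Simple nb) {V : Subset n} {v : Fin n} (v∈V : v ∈ V) where

  open Simple simple

  add-to-tree : ∀ {S x i w} → v ∈ S → x ∉ S → w ∈ S → nb x i ≡ just w →
                (∀ j → nb x j ≡ just v → j ≡ i) → InTree nb v S → InTree nb v (S ∪ ⁅ x ⁆)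
  add-to-tree {S} {x} {i} {w} v∈S x∉S w∈S e only T = record
    { t = t [ x ≔ i ] ; height = h′ ; descends = descends′ ; to-root = to-root′ }
    where
    open InTree T
    h′ = height [ x ≔ suc (height w) ]

    old : ∀ {y} → y ∈ S → h′ y ≡ height y
    old y∈S = ≔-other height λ { refl → x∉S y∈S }

    descends′ : ∀ {y} → y ∈ S ∪ ⁅ x ⁆ → y ≢ v →
                ∃[ z ] nb y ((t [ x ≔ i ]) y) ≡ just z × z ∈ S ∪ ⁅ x ⁆ × h′ z < h′ y
    descends′ {y} y∈ y≢v with y ≟ x
    ... | yes refl = w , trans (cong (nb x) (≔-same t x)) e , ∈-insert-old w∈S ,
      subst₂ _<_ (sym (old w∈S)) (sym (≔-same height x)) ℕₚ.≤-refl
    ... | no y≢x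
      with z , e′ , z∈S , lt ← descends (∈-insert⁻ y∈ y≢x) y≢v =
      z , trans (cong (nb y) (≔-other t y≢x)) e′ , ∈-insert-old z∈S ,
      subst₂ _<_ (sym (old z∈S)) (sym (old (∈-insert⁻ y∈ y≢x))) lt

    to-root′ : ∀ {y j} → y ∈ S ∪ ⁅ x ⁆ → y ≢ v → nb y j ≡ just v → j ≡ (t [ x ≔ i ]) y
    to-root′ {y} {j} y∈ y≢v e′ with y ≟ x
    ... | yes refl = trans (only j e′) (sym (≔-same t x))
    ... | no y≢x   = trans (to-root (∈-insert⁻ y∈ y≢x) y≢v e′) (sym (≔-other t y≢x))

  Closed : Subset n → Set
  Closed S = ∀ {x i w} → x ∈ V → w ∈ S → nb x i ≡ just w → x ∈ S

  -- Growth against the arcs stops at the set of vertices of `V` that reach `v`. It need not be `V`,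
  -- but `Closed` is then the condition under which it can be split off by `glue`.
  spanning-tree : (Fin n → Fin p) → ∃[ S ] v ∈ S × S ⊆ V × Closed S × InTree nb v S
  spanning-tree t₀ = grow {P = λ S → v ∈ S × S ⊆ V × InTree nb v S} extend ⁅ v ⁆
    ( x∈⁅x⁆ v , ⁅⁆⊆ v∈V
    , record { t = t₀ ; height = λ _ → 0
             ; descends = λ x∈ x≢v → contradiction (x∈⁅y⁆⇒x≡y v x∈) x≢v
             ; to-root  = λ x∈ x≢v → contradiction (x∈⁅y⁆⇒x≡y v x∈) x≢v } )
    where
    arc? : ∀ x i w → Dec (nb x i ≡ just w)
    arc? x i w = ≡-dec _≟_ (nb x i) (just w)

    extend : ∀ S → v ∈ S × S ⊆ V × InTree nb v S →
             (∃[ S ] v ∈ S × S ⊆ V × Closed S × InTree nb v S) ⊎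
             (∃[ x ] x ∉ S × (v ∈ S ∪ ⁅ x ⁆ × S ∪ ⁅ x ⁆ ⊆ V × InTree nb v (S ∪ ⁅ x ⁆)))
    extend S (v∈S , S⊆V , T)
      with any? (λ x → (x ∈? V) ×-dec ¬? (x ∈? S) ×-dec
                       any? λ i → any? λ w → (w ∈? S) ×-dec arc? x i w)
    ... | no none = inj₁ (S , v∈S , S⊆V , closed , T)
      where
      closed : Closed S
      closed {x} {i} {w} x∈V w∈S e =
        decidable-stable (x ∈? S) λ x∉S → none (x , x∈V , x∉S , i , w , w∈S , e)
    ... | yes (x , x∈V , x∉S , i , w , w∈S , e) =
      inj₂ (x , x∉S , ∈-insert-old v∈S , ⊆V , T′)
      where
      ⊆V : S ∪ ⁅ x ⁆ ⊆ V
      ⊆V y∈ = [ S⊆V , ⁅⁆⊆ x∈V ]′ (x∈p∪q⁻ S ⁅ x ⁆ y∈)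
      T′ : InTree nb v (S ∪ ⁅ x ⁆)
      -- An arc from `x` straight to the root takes precedence over the arc that was found, since
      -- `to-root` wants every arc to `v` in the tree; being simple, the digraph has at most one
      -- from `x`.
      T′ with any? (λ j → arc? x j v)
      ... | yes (j , e′) = add-to-tree v∈S x∉S v∈S e′ (λ k e″ → no-parallel e″ e′) T
      ... | no  none     = add-to-tree v∈S x∉S w∈S e (λ k e″ → contradiction (k , e″) none) T

-- The number of slots and the arcs vary along with the vertex set, because removing a tree changes
-- both.
DecomposableBelow : Subset n → Set
DecomposableBelow V = ∀ {p} {nb : Arcs _ p} → Simple nb → ∀ {W} → W ⊂ V → ∀ u → Decomposition nb W u

-- If some vertex of `V` does not reach `v`, then `V` falls into two smaller sets with arcs in one
-- direction only. Otherwise the tree spans `V`, and `v` can be removed.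
decompose-via-arc : ∀ {nb : Arcs n p} → Simple nb → ∀ {V} → DecomposableBelow V → ∀ {u v i} →
                    u ∈ V → v ∈ V → nb v i ≡ just u → Decomposition nb V u
decompose-via-arc {p = suc p} simple {V} below {u} {v} {i} u∈V v∈V v→u
  with S , v∈S , S⊆V , closed , T ← spanning-tree simple v∈V (λ _ → i)
  with any? (λ x → (x ∈? V) ×-dec ¬? (x ∈? S))
... | yes (x , x∈V , x∉S) =
  glue S⊆V (λ y∈ w∈S e → ∈─⁻ V S y∈ (closed (p─q⊆p V S y∈) w∈S e))
    (below simple (S⊆V , x , x∈V , x∉S) u)
    (below simple (p∩q≢∅⇒p─q⊂p V S (v , x∈p∩q⁺ (v∈V , v∈S))) u)
... | no none
  with refl ← ⊆-antisym S⊆V (λ {x} x∈V → decidable-stable (x ∈? S) λ x∉S → none (x , x∈V , x∉S)) =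
  extend-by-tree (below rest-simple (x∈p⇒p-x⊂p v∈V) u)
  where open ExtendByTree simple u∈V v∈V v→u T

-- If no arc of `V` enters `u`, then `u` alone is a side for `glue`, and its own arcs go to distinct
-- forests, so none is a galaxy arc.
decompose-inside : ∀ {nb : Arcs n p} → Simple nb → ∀ {V} → DecomposableBelow V → ∀ {u} →
                   u ∈ V → Decomposition nb V u
decompose-inside {nb = nb} simple {V} below {u} u∈V
  with any? (λ v → (v ∈? V) ×-dec any? λ i → ≡-dec _≟_ (nb v i) (just u))
... | yes (v , v∈V , i , v→u) = decompose-via-arc simple below u∈V v∈V v→u
... | no none =
  glue (⁅⁆⊆ u∈V)
    (λ v∈ w∈ e → no-arc (p─q⊆p V ⁅ u ⁆ v∈) w∈ e)
    (arcless-decomposition λ v∈ → no-arc (⁅⁆⊆ u∈V v∈))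
    (below simple (x∈p⇒p-x⊂p u∈V) u)
  where
  no-arc : ∀ {v i w} → v ∈ V → w ∈ ⁅ u ⁆ → nb v i ≢ just w
  no-arc v∈V w∈ e with refl ← x∈⁅y⁆⇒x≡y u w∈ = none (_ , v∈V , _ , e)

decompose : ∀ {nb : Arcs n p} → Simple nb → ∀ V u → Decomposition nb V u
decompose simple V = go (⊂-wellFounded V) simple
  where
  go : ∀ {V} → Acc _⊂_ V → ∀ {p} {nb : Arcs _ p} → Simple nb → ∀ u → Decomposition nb V u
  go {V} (acc rec) simple u with u ∈? V | nonempty? V
  ... | yes u∈V | _ = decompose-inside simple (λ s W⊂V → go (rec W⊂V) s) u∈V
  -- For `u` outside `V` the field `avoids` is vacuous, so any vertex of `V` can stand in for `u`.
  ... | no u∉V | yes (x , x∈V) = record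
    { lab = lab ; rank = rank ; lab-inj = lab-inj ; descend = descend ; galaxy = galaxy
    ; avoids = λ u∈V → contradiction u∈V u∉V }
    where open Decomposition (decompose-inside simple (λ s W⊂V → go (rec W⊂V) s) x∈V)
  ... | no _ | no empty = arcless-decomposition λ v∈V → contradiction (_ , v∈V) empty

-- Subsets cut out by decidable predicates

module _ {P : Fin n → Set} (P? : Decidable P) where

  -- Has the shape of `LabelsAt`, so that membership in label sets is an instance by computation.
  select : Subset n
  select = tabulate (does ∘ P?)

  ∈select⁺ : ∀ {x} → P x → x ∈ select
  ∈select⁺ {x} Px = lookup⇒[]= x select (trans (lookup∘tabulate _ x) (dec-true (P? x) Px))

  ∈select⁻ : ∀ {x} → x ∈ select → P x
  ∈select⁻ {x} x∈ with P? x | trans (sym (lookup∘tabulate (does ∘ P?) x)) ([]=⇒lookup x∈)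
  ... | yes Px | _ = Px

-- Forests drawn on one page

Crossing : (l h l′ h′ : ℕ) → Set
Crossing l h l′ h′ = (l < l′ × l′ < h × h < h′) ⊎ (l′ < l × l < h′ × h′ < h)

Monotone : (ℕ → ℕ) → Set
Monotone ρ = ∀ {a b} → a ≤ b → ρ a ≤ ρ b

-- A crossing consists of strict inequalities, and monotone maps reflect these even when they are
-- not injective. This serves both the doubling of positions and their compression.
crossing-reflect : ∀ {ρ} → Monotone ρ → ∀ {l h l′ h′} →
                   Crossing (ρ l) (ρ h) (ρ l′) (ρ h′) → Crossing l h l′ h′
crossing-reflect {ρ} mono = λ where
    (inj₁ (a , b , c)) → inj₁ (reflect a , reflect b , reflect c)
    (inj₂ (a , b , c)) → inj₂ (reflect a , reflect b , reflect c)
  where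
  reflect : ∀ {a b} → ρ a < ρ b → a < b
  reflect lt = ℕₚ.≰⇒> λ b≤a → ℕₚ.<⇒≱ lt (mono b≤a)

consecutive-uncrossed : ∀ a {l h} → ¬ Crossing a (suc a) l h
consecutive-uncrossed a (inj₁ (a<l , l<sa , _)) = ℕₚ.<⇒≱ a<l (ℕₚ.≤-pred l<sa)
consecutive-uncrossed a (inj₂ (_ , a<h , h<sa)) = ℕₚ.<⇒≱ a<h (ℕₚ.≤-pred h<sa)

-- Positions are natural numbers here to leave room for inserting vertices; they are squeezed into
-- `Fin n` only at the end.
module Span (tail head : Fin m → Fin n) (pos : Fin n → ℕ) where
  low high : Fin m → ℕ
  low  e = pos (tail e) ⊓ pos (head e)
  high e = pos (tail e) ⊔ pos (head e)

  Crosses : Fin m → Fin m → Set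
  Crosses e f = Crossing (low e) (high e) (low f) (high f)

-- At most one edge of `K` leaves each vertex and ranks fall along edges, so `K` is a forest
-- directed towards its roots, with `head e` the parent of `tail e`.
module Forest (tail head : Fin m → Fin n) {K : Fin m → Set} (K? : Decidable K)
              (rank : Fin n → ℕ) (descend : ∀ {e} → K e → rank (head e) < rank (tail e))
              (tail-inj : ∀ {e f} → K e → K f → tail e ≡ tail f → e ≡ f) where

  -- Parents come before children: a vertex of least rank outside `S` has its parent, if any, in
  -- `S`.
  induction : (P : Subset n → Set) → P ⊥ →
              (∀ S x → x ∉ S → (∀ e → K e → tail e ≡ x → head e ∈ S) → P S → P (S ∪ ⁅ x ⁆)) →
              P ⊤
  induction P P⊥ add = grow extend ⊥ P⊥
    where
    extend : ∀ S → P S → P ⊤ ⊎ (∃[ x ] x ∉ S × P (S ∪ ⁅ x ⁆))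
    extend S PS with any? (λ x → ¬? (x ∈? S) ×-dec
                          all? λ e → K? e →-dec ((tail e ≟ x) →-dec (head e ∈? S)))
    ... | yes (x , x∉S , ok) = inj₂ (x , x∉S , add S x x∉S ok PS)
    ... | no none = inj₁ (subst P (⊆-antisym ⊆⊤ (λ {x} _ → full (rank x) x refl)) PS)
      where
      full : ∀ k x → rank x ≡ k → x ∈ S
      full = <-rec _ λ { k ih x refl → decidable-stable (x ∈? S) λ x∉S →
        none (x , x∉S , λ { e Ke refl → ih (descend Ke) (head e) refl }) }

  out-edge? : ∀ x → Dec (∃[ e ] K e × tail e ≡ x)
  out-edge? x = any? λ e → K? e ×-dec (tail e ≟ x)

  -- Parity of the depth. Among edges whose tails have the same colour, no head is a tail, so these
  -- edges form stars centred at their heads.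
  2-colouring : ∃[ c ] ∀ {e} → K e → c (tail e) ≡ not (c (head e))
  2-colouring =
    let c , ok = induction P ((λ _ → false) , λ _ t∈ → contradiction t∈ ∉⊥) add in
    c , λ Ke → proj₂ (ok Ke ∈⊤)
    where
    P : Subset n → Set
    P S = ∃[ c ] ∀ {e} → K e → tail e ∈ S → head e ∈ S × c (tail e) ≡ not (c (head e))

    add : ∀ S x → x ∉ S → (∀ e → K e → tail e ≡ x → head e ∈ S) → P S → P (S ∪ ⁅ x ⁆)
    add S x x∉S ready (c , ok) = c [ x ≔ colour ] , ok′
      where
      colour : Bool
      colour with out-edge? x
      ... | yes (e , _) = not (c (head e))
      ... | no  _       = false

      colour-edge : ∀ {e} → K e → tail e ≡ x → colour ≡ not (c (head e))
      colour-edge Ke te with out-edge? x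
      ... | yes (f , Kf , tf) = cong (not ∘ c ∘ head) (tail-inj Kf Ke (trans tf (sym te)))
      ... | no  none          = contradiction (_ , Ke , te) none

      old : ∀ {y} → y ∈ S → (c [ x ≔ colour ]) y ≡ c y
      old y∈S = ≔-other c λ { refl → x∉S y∈S }

      ok′ : ∀ {e} → K e → tail e ∈ S ∪ ⁅ x ⁆ →
            head e ∈ S ∪ ⁅ x ⁆ × (c [ x ≔ colour ]) (tail e) ≡ not ((c [ x ≔ colour ]) (head e))
      ok′ {e} Ke t∈ with tail e ≟ x
      ... | yes te = ∈-insert-old h∈S ,
        trans (trans (cong (c [ x ≔ colour ]) te) (≔-same c x))
              (trans (colour-edge Ke te) (cong not (sym (old h∈S))))
        where h∈S = ready e Ke te
      ... | no te≢x with t∈S ← ∈-insert⁻ t∈ te≢x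
        with h∈S , eq ← ok Ke t∈S =
        ∈-insert-old h∈S , trans (old t∈S) (trans eq (cong not (sym (old h∈S))))

  open Span tail head

  -- A new vertex is inserted immediately after its parent, so that its edge spans
  -- consecutive positions.
  1-page : ∃[ pos ] Injective _≡_ _≡_ pos × (∀ {e f} → K e → K f → ¬ Crosses pos e f)
  1-page =
    let pos , inj , _ , ok = induction P
          ( toℕ , toℕ-injective , (λ _ t∈ → contradiction t∈ ∉⊥)
          , λ _ _ t∈ → contradiction t∈ ∉⊥ ) add in
    pos , inj , λ Ke Kf → ok Ke Kf ∈⊤ ∈⊤
    where
    P : Subset n → Set
    P S = ∃[ pos ] Injective _≡_ _≡_ pos ×
          (∀ {e} → K e → tail e ∈ S → head e ∈ S) ×
          (∀ {e f} → K e → K f → tail e ∈ S → tail f ∈ S → ¬ Crosses pos e f)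

    add : ∀ S x → x ∉ S → (∀ e → K e → tail e ≡ x → head e ∈ S) → P S → P (S ∪ ⁅ x ⁆)
    add S x x∉S ready (pos , inj , heads , ok) with out-edge? x
    ... | no none = pos , inj , (λ Ke t∈ → ∈-insert-old (heads Ke (in-S Ke t∈))) ,
                    λ Ke Kf t∈ t′∈ → ok Ke Kf (in-S Ke t∈) (in-S Kf t′∈)
      where
      in-S : ∀ {e} → K e → tail e ∈ S ∪ ⁅ x ⁆ → tail e ∈ S
      in-S Ke t∈ = ∈-insert⁻ t∈ λ te → none (_ , Ke , te)
    ... | yes (e₀ , Ke₀ , te₀) = pos′ , inj′ , heads′ , ok′
      where
      w = head e₀
      -- Doubling moves every vertex to an even position, including those not yet added, and so
      -- vacates the place right after `w`.
      pos′ = (λ y → 2 ℕ.* pos y) [ x ≔ suc (2 ℕ.* pos w) ]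

      at-x : pos′ x ≡ suc (2 ℕ.* pos w)
      at-x = ≔-same (λ y → 2 ℕ.* pos y) x

      off-x : ∀ {y} → y ≢ x → pos′ y ≡ 2 ℕ.* pos y
      off-x = ≔-other (λ y → 2 ℕ.* pos y)

      in-S : ∀ {y} → y ∈ S → pos′ y ≡ 2 ℕ.* pos y
      in-S y∈S = off-x λ { refl → x∉S y∈S }

      odd≢even : ∀ a b → suc (2 ℕ.* a) ≢ 2 ℕ.* b
      odd≢even a (suc b) eq = odd≢even b a (sym (ℕₚ.suc-injective (trans eq (ℕₚ.*-suc 2 b))))

      inj′ : Injective _≡_ _≡_ pos′
      inj′ {y} {z} eq with y ≟ x | z ≟ x
      ... | yes refl | yes refl = refl
      ... | yes refl | no z≢x =
        contradiction (trans (sym at-x) (trans eq (off-x z≢x))) (odd≢even (pos w) (pos z))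
      ... | no y≢x | yes refl =
        contradiction (trans (sym at-x) (trans (sym eq) (off-x y≢x))) (odd≢even (pos w) (pos y))
      ... | no y≢x | no z≢x = inj (ℕₚ.*-cancelˡ-≡ _ _ 2 (trans (sym (off-x y≢x)) (trans eq (off-x z≢x))))

      heads′ : ∀ {e} → K e → tail e ∈ S ∪ ⁅ x ⁆ → head e ∈ S ∪ ⁅ x ⁆
      heads′ {e} Ke t∈ with tail e ≟ x
      ... | yes te = ∈-insert-old (ready e Ke te)
      ... | no te≢x = ∈-insert-old (heads Ke (∈-insert⁻ t∈ te≢x))

      low-new : ∀ {e} → K e → tail e ≡ x → low pos′ e ≡ 2 ℕ.* pos w
      low-new Ke te with refl ← tail-inj Ke₀ Ke (trans te₀ (sym te)) =
        trans (cong₂ _⊓_ (trans (cong pos′ te) at-x) (in-S (ready _ Ke te)))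
              (ℕₚ.m≥n⇒m⊓n≡n (ℕₚ.n≤1+n _))

      high-new : ∀ {e} → K e → tail e ≡ x → high pos′ e ≡ suc (2 ℕ.* pos w)
      high-new Ke te with refl ← tail-inj Ke₀ Ke (trans te₀ (sym te)) =
        trans (cong₂ _⊔_ (trans (cong pos′ te) at-x) (in-S (ready _ Ke te)))
              (ℕₚ.m≥n⇒m⊔n≡m (ℕₚ.n≤1+n _))

      low-old : ∀ {e} → K e → tail e ∈ S → low pos′ e ≡ 2 ℕ.* low pos e
      low-old {e} Ke t∈ = trans (cong₂ _⊓_ (in-S t∈) (in-S (heads Ke t∈)))
        (sym (ℕₚ.*-distribˡ-⊓ 2 (pos (tail e)) _))

      high-old : ∀ {e} → K e → tail e ∈ S → high pos′ e ≡ 2 ℕ.* high pos e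
      high-old {e} Ke t∈ = trans (cong₂ _⊔_ (in-S t∈) (in-S (heads Ke t∈)))
        (sym (ℕₚ.*-distribˡ-⊔ 2 (pos (tail e)) _))

      new-ok : ∀ {e f} → K e → tail e ≡ x → ¬ Crosses pos′ e f
      new-ok Ke te cross rewrite low-new Ke te | high-new Ke te = consecutive-uncrossed _ cross

      ok′ : ∀ {e f} → K e → K f → tail e ∈ S ∪ ⁅ x ⁆ → tail f ∈ S ∪ ⁅ x ⁆ → ¬ Crosses pos′ e f
      ok′ {e} {f} Ke Kf t∈ t′∈ cross with tail e ≟ x | tail f ≟ x
      ... | yes te | _ = new-ok {f = f} Ke te cross
      ... | no _ | yes tf = new-ok {f = e} Kf tf (swap cross)
      ... | no te≢x | no tf≢x
        rewrite low-old Ke (∈-insert⁻ t∈ te≢x) | high-old Ke (∈-insert⁻ t∈ te≢x)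
              | low-old Kf (∈-insert⁻ t′∈ tf≢x) | high-old Kf (∈-insert⁻ t′∈ tf≢x) =
        ok Ke Kf (∈-insert⁻ t∈ te≢x) (∈-insert⁻ t′∈ tf≢x)
           (crossing-reflect {ρ = 2 ℕ.*_} (ℕₚ.*-monoʳ-≤ 2) cross)

-- Compression of positions to a permutation

module _ (pos : Fin n → ℕ) (pos-inj : Injective _≡_ _≡_ pos) where

  private

    below : ℕ → Subset n
    below a = select λ u → pos u ℕ.<? a

    order-index : ℕ → ℕ
    order-index a = ∣ below a ∣

    order-index-mono : Monotone order-index
    order-index-mono {a} {b} a≤b = p⊆q⇒∣p∣≤∣q∣ {p = below a} {q = below b} λ u∈ →
      ∈select⁺ (λ u → pos u ℕ.<? b) (ℕₚ.<-≤-trans (∈select⁻ (λ u → pos u ℕ.<? a) u∈) a≤b)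

    order-index-< : ∀ v {T} → below (pos v) ⊆ T → v ∈ T → order-index (pos v) < ∣ T ∣
    order-index-< v ⊆T v∈T = p⊂q⇒∣p∣<∣q∣ (⊆T , v , v∈T , λ v∈ →
      ℕₚ.<-irrefl refl (∈select⁻ (λ u → pos u ℕ.<? pos v) v∈))

    compress : Fin n → Fin n
    compress v = fromℕ< (subst (order-index (pos v) <_) (∣⊤∣≡n n) (order-index-< v {⊤} ⊆⊤ ∈⊤))

    toℕ-compress : ∀ v → toℕ (compress v) ≡ order-index (pos v)
    toℕ-compress v = toℕ-fromℕ< _

    order-index-strict : ∀ {u v} → pos u < pos v → order-index (pos u) < order-index (pos v)
    order-index-strict {u} {v} lt = order-index-< u {below (pos v)}
      (λ w∈ → ∈select⁺ (λ w → pos w ℕ.<? pos v) (ℕₚ.<-trans (∈select⁻ (λ w → pos w ℕ.<? pos u) w∈) lt))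
      (∈select⁺ (λ w → pos w ℕ.<? pos v) lt)

    compress-injective : Injective _≡_ _≡_ compress
    compress-injective {u} {v} eq = pos-inj (ℕₚ.≤-antisym
      (ℕₚ.≮⇒≥ λ lt → ℕₚ.<-irrefl (sym eq′) (order-index-strict lt))
      (ℕₚ.≮⇒≥ λ lt → ℕₚ.<-irrefl eq′ (order-index-strict lt)))
      where
      eq′ : order-index (pos u) ≡ order-index (pos v)
      eq′ = trans (sym (toℕ-compress u)) (trans (cong toℕ eq) (toℕ-compress v))

  -- A position is replaced by the number of vertices before it. This is monotone on all of ℕ, hence
  -- commutes with minima and maxima and reflects crossings.
  order-preserving-compression :
    ∃[ pos′ ] ∃[ ρ ] Injective {A = Fin n} {B = Fin n} _≡_ _≡_ pos′ × Monotone ρ ×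
                     (∀ v → toℕ (pos′ v) ≡ ρ (pos v))
  order-preserving-compression =
    compress , order-index , compress-injective , order-index-mono , toℕ-compress

-- Cardinalities by injections

index : ∀ (S : Subset n) {x} → x ∈ S → Fin ∣ S ∣
index (true  ∷ S) here       = zero
index (true  ∷ S) (there x∈) = suc (index S x∈)
index (false ∷ S) (there x∈) = index S x∈

index-injective : ∀ (S : Subset n) {x y} (x∈ : x ∈ S) (y∈ : y ∈ S) → index S x∈ ≡ index S y∈ → x ≡ y
index-injective (true  ∷ S) here       here       eq = refl
index-injective (true  ∷ S) (there x∈) (there y∈) eq = cong suc (index-injective S x∈ y∈ (suc-injective eq))
index-injective (false ∷ S) (there x∈) (there y∈) eq = cong suc (index-injective S x∈ y∈ eq)

element : ∀ (S : Subset n) → Fin ∣ S ∣ → ∃[ x ] x ∈ S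
element (true  ∷ S) zero    = zero , here
element (true  ∷ S) (suc i) = let x , x∈ = element S i in suc x , there x∈
element (false ∷ S) i       = let x , x∈ = element S i in suc x , there x∈

index-element : ∀ (S : Subset n) i → index S (proj₂ (element S i)) ≡ i
index-element (true  ∷ S) zero    = refl
index-element (true  ∷ S) (suc i) = cong suc (index-element S i)
index-element (false ∷ S) i       = index-element S i

index-cong : ∀ (S : Subset n) {x y} (x∈ : x ∈ S) (y∈ : y ∈ S) → x ≡ y → index S x∈ ≡ index S y∈
index-cong (true  ∷ S) here       here       refl = refl
index-cong (true  ∷ S) (there x∈) (there y∈) refl = cong suc (index-cong S x∈ y∈ refl)
index-cong (false ∷ S) (there x∈) (there y∈) refl = index-cong S x∈ y∈ refl

element-injective : ∀ (S : Subset n) {i j} → proj₁ (element S i) ≡ proj₁ (element S j) → i ≡ j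
element-injective S {i} {j} eq =
  trans (sym (index-element S i)) (trans (index-cong S _ _ eq) (index-element S j))

injection⇒∣∣≤ : ∀ (S : Subset n) {k} (f : ∀ {x} → x ∈ S → Fin k) →
                (∀ {x y} (x∈ : x ∈ S) (y∈ : y ∈ S) → f x∈ ≡ f y∈ → x ≡ y) → ∣ S ∣ ≤ k
injection⇒∣∣≤ S f f-inj = injective⇒≤ {f = λ i → f (proj₂ (element S i))}
  λ eq → element-injective S (f-inj _ _ eq)

injection⇒≤∣∣ : ∀ (S : Subset n) {k} (f : Fin k → Fin n) → (∀ i → f i ∈ S) →
                Injective _≡_ _≡_ f → k ≤ ∣ S ∣
injection⇒≤∣∣ S f f∈ f-inj = injective⇒≤ {f = λ i → index S (f∈ i)}
  λ eq → f-inj (index-injective S _ _ eq)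

-- Counting the edges of union embeddings

crossing-distinct : ∀ {l h l′ h′ a} → Crossing l h l′ h′ → a ≡ l ⊎ a ≡ h → ¬ (a ≡ l′ ⊎ a ≡ h′)
crossing-distinct (inj₁ (x , y , z)) (inj₁ refl) (inj₁ refl) = ℕₚ.<-irrefl refl x
crossing-distinct (inj₁ (x , y , z)) (inj₁ refl) (inj₂ refl) = ℕₚ.<-irrefl refl (ℕₚ.<-trans x (ℕₚ.<-trans y z))
crossing-distinct (inj₁ (x , y , z)) (inj₂ refl) (inj₁ refl) = ℕₚ.<-irrefl refl y
crossing-distinct (inj₁ (x , y , z)) (inj₂ refl) (inj₂ refl) = ℕₚ.<-irrefl refl z
crossing-distinct (inj₂ (x , y , z)) (inj₁ refl) (inj₁ refl) = ℕₚ.<-irrefl refl x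
crossing-distinct (inj₂ (x , y , z)) (inj₁ refl) (inj₂ refl) = ℕₚ.<-irrefl refl y
crossing-distinct (inj₂ (x , y , z)) (inj₂ refl) (inj₁ refl) = ℕₚ.<-irrefl refl (ℕₚ.<-trans x (ℕₚ.<-trans y z))
crossing-distinct (inj₂ (x , y , z)) (inj₂ refl) (inj₂ refl) = ℕₚ.<-irrefl refl z

module _ (G : Graph) where
  open Graph G renaming (n to ∣V∣; m to ∣E∣)

  incident? : ∀ e v → Dec (Incident G e v)
  incident? e v = (src e ≟ v) ⊎-dec (tgt e ≟ v)

  module _ {q} (lab : Fin ∣E∣ → Fin q) where

    labelAt? : ∀ v → Decidable (λ i → ∃[ e ] Incident G e v × lab e ≡ i)
    labelAt? v i = any? λ e → incident? e v ×-dec (lab e ≟ i)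

    ∈LabelsAt⁺ : ∀ {v e} → Incident G e v → lab e ∈ LabelsAt G lab v
    ∈LabelsAt⁺ {v} {e} inc = ∈select⁺ (labelAt? v) (e , inc , refl)

    ∈LabelsAt⁻ : ∀ {v i} → i ∈ LabelsAt G lab v → ∃[ e ] Incident G e v × lab e ≡ i
    ∈LabelsAt⁻ {v} = ∈select⁻ (labelAt? v)

  conn-label : ∀ {q} {lab : Fin ∣E∣ → Fin q} {e f} → Conn G lab e f → lab e ≡ lab f
  conn-label here           = refl
  conn-label (step c l≡ _) = trans (conn-label c) (sym l≡)

  module _ (pos : Fin ∣V∣ → Fin ∣V∣) where

    end-lo-hi : ∀ {e v} → Incident G e v → toℕ (pos v) ≡ lo G pos e ⊎ toℕ (pos v) ≡ hi G pos e
    end-lo-hi {e} inc with ℕₚ.≤-total (toℕ (pos (src e))) (toℕ (pos (tgt e))) | inc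
    ... | inj₁ s≤t | inj₁ refl = inj₁ (sym (ℕₚ.m≤n⇒m⊓n≡m s≤t))
    ... | inj₁ s≤t | inj₂ refl = inj₂ (sym (ℕₚ.m≤n⇒m⊔n≡n s≤t))
    ... | inj₂ t≤s | inj₁ refl = inj₂ (sym (ℕₚ.m≥n⇒m⊔n≡m t≤s))
    ... | inj₂ t≤s | inj₂ refl = inj₁ (sym (ℕₚ.m≥n⇒m⊓n≡n t≤s))

    share⇒uncrossed : ∀ {e f} → ShareEnd G e f → ¬ Cross G pos e f
    share⇒uncrossed {e} {f} (v , ve , vf) cross =
      crossing-distinct cross (end-lo-hi {e} ve) (end-lo-hi {f} vf)

    -- The count below excludes crossings only between connected edges of a page, so with this step
    -- it covers both lower bounds.
    book⇒union : ∀ {q} {page : Fin ∣E∣ → Fin q} → IsBook G pos page → IsUnion G pos page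
    book⇒union book e f c = book e f (conn-label c)

  -- With the stars as pages, edges of a page meet at the centre and cannot cross, so any vertex
  -- order will do.
  localStar⇒localBook : ∀ {k} → HasLocalStar G k → HasLocalBook G k
  localStar⇒localBook (q , star , centre , central , local) =
    id , id , q , star ,
    (λ e f same → share⇒uncrossed id
      (centre (star e) , central e , subst (Incident G f ∘ centre) (sym same) (central f))) ,
    local

  starForests⇒union : ∀ {k} → HasStarForests G k → HasUnion G k
  starForests⇒union (cls , stars) =
    id , id , cls , λ e f c → let v , central = stars e in
      share⇒uncrossed id (v , central e here , central f c)

  module Charge (pos : Fin ∣V∣ → Fin ∣V∣) (pos-inj : Injective _≡_ _≡_ pos)
                {q} (page : Fin ∣E∣ → Fin q) (union : IsUnion G pos page) where

    private
      l h : Fin ∣E∣ → ℕ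
      l = lo G pos
      h = hi G pos

    ends : ∀ e → ∃[ a ] ∃[ b ] Incident G e a × Incident G e b ×
                 toℕ (pos a) ≡ l e × toℕ (pos b) ≡ h e
    ends e with ℕₚ.≤-total (toℕ (pos (src e))) (toℕ (pos (tgt e)))
    ... | inj₁ s≤t = src e , tgt e , inj₁ refl , inj₂ refl ,
                     sym (ℕₚ.m≤n⇒m⊓n≡m s≤t) , sym (ℕₚ.m≤n⇒m⊔n≡n s≤t)
    ... | inj₂ t≤s = tgt e , src e , inj₂ refl , inj₁ refl ,
                     sym (ℕₚ.m≥n⇒m⊓n≡n t≤s) , sym (ℕₚ.m≥n⇒m⊔n≡m t≤s)

    pos-injective : ∀ {a b} → toℕ (pos a) ≡ toℕ (pos b) → a ≡ b
    pos-injective eq = pos-inj (toℕ-injective eq)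

    lo-share : ∀ {e f} → l e ≡ l f → ShareEnd G e f
    lo-share {e} {f} eq with ends e | ends f
    ... | a , _ , ae , _ , la , _ | a′ , _ , a′f , _ , la′ , _ =
      a , ae , subst (Incident G f) (pos-injective (trans la′ (trans (sym eq) (sym la)))) a′f

    hi-share : ∀ {e f} → h e ≡ h f → ShareEnd G e f
    hi-share {e} {f} eq with ends e | ends f
    ... | _ , b , _ , be , _ , hb | _ , b′ , _ , b′f , _ , hb′ =
      b , be , subst (Incident G f) (pos-injective (trans hb′ (trans (sym eq) (sym hb)))) b′f

    span-injective : ∀ {e f} → l e ≡ l f → h e ≡ h f → e ≡ f
    span-injective {e} {f} l≡ h≡
      with ℕₚ.≤-total (toℕ (pos (src e))) (toℕ (pos (tgt e)))
         | ℕₚ.≤-total (toℕ (pos (src f))) (toℕ (pos (tgt f)))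
    ... | inj₁ e≤ | inj₁ f≤
      rewrite ℕₚ.m≤n⇒m⊓n≡m e≤ | ℕₚ.m≤n⇒m⊔n≡n e≤ | ℕₚ.m≤n⇒m⊓n≡m f≤ | ℕₚ.m≤n⇒m⊔n≡n f≤ =
      simple e f (pos-injective l≡) (pos-injective h≡)
    ... | inj₂ e≥ | inj₂ f≥
      rewrite ℕₚ.m≥n⇒m⊓n≡n e≥ | ℕₚ.m≥n⇒m⊔n≡m e≥ | ℕₚ.m≥n⇒m⊓n≡n f≥ | ℕₚ.m≥n⇒m⊔n≡m f≥ =
      simple e f (pos-injective h≡) (pos-injective l≡)
    ... | inj₁ e≤ | inj₂ f≥
      rewrite ℕₚ.m≤n⇒m⊓n≡m e≤ | ℕₚ.m≤n⇒m⊔n≡n e≤ | ℕₚ.m≥n⇒m⊓n≡n f≥ | ℕₚ.m≥n⇒m⊔n≡m f≥ =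
      contradiction (src<tgt f)
        (<-asym (subst₂ (λ x y → toℕ x < toℕ y) (pos-injective l≡) (pos-injective h≡) (src<tgt e)))
    ... | inj₂ e≥ | inj₁ f≤
      rewrite ℕₚ.m≥n⇒m⊓n≡n e≥ | ℕₚ.m≥n⇒m⊔n≡m e≥ | ℕₚ.m≤n⇒m⊓n≡m f≤ | ℕₚ.m≤n⇒m⊔n≡n f≤ =
      contradiction (src<tgt f)
        (<-asym (subst₂ (λ x y → toℕ x < toℕ y) (pos-injective h≡) (pos-injective l≡) (src<tgt e)))

    Exceeded : Fin ∣E∣ → Set
    Exceeded e = ∃[ f ] page f ≡ page e × l f ≡ l e × h e < h f

    exceeded? : Decidable Exceeded
    exceeded? e = any? λ f → (page f ≟ page e) ×-dec (l f ℕ.≟ l e) ×-dec (h e ℕ.<? h f)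

    lower-unique : ∀ {e f} → ¬ Exceeded e → ¬ Exceeded f → page e ≡ page f → l e ≡ l f → e ≡ f
    lower-unique ¬e ¬f p≡ l≡ = span-injective l≡ (ℕₚ.≤-antisym
      (ℕₚ.≮⇒≥ λ lt → ¬f (_ , p≡ , l≡ , lt))
      (ℕₚ.≮⇒≥ λ lt → ¬e (_ , sym p≡ , sym l≡ , lt)))

    l<h : ∀ e → l e < h e
    l<h e with ℕₚ.<-cmp (toℕ (pos (src e))) (toℕ (pos (tgt e)))
    ... | tri< lt _ _ rewrite ℕₚ.m≤n⇒m⊓n≡m (ℕₚ.<⇒≤ lt) | ℕₚ.m≤n⇒m⊔n≡n (ℕₚ.<⇒≤ lt) = lt
    ... | tri≈ _ eq _ = contradiction (src<tgt e) (ℕₚ.<-irrefl (cong toℕ (pos-injective eq)))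
    ... | tri> _ _ gt rewrite ℕₚ.m≥n⇒m⊓n≡n (ℕₚ.<⇒≤ gt) | ℕₚ.m≥n⇒m⊔n≡m (ℕₚ.<⇒≤ gt) = gt

    -- The longer edge g at the lower end of f would cross e.
    upper-≮ : ∀ {e f} → Exceeded f → page e ≡ page f → h e ≡ h f → ¬ l e < l f
    upper-≮ {e} {f} (g , g≡f , lg≡lf , hf<hg) p≡ h≡ le<lf = union e g
      (step (step here (sym p≡) (hi-share {e} {f} h≡)) g≡f (lo-share {f} {g} (sym lg≡lf)))
      (inj₁ ( subst (l e <_) (sym lg≡lf) le<lf
            , subst₂ _<_ (sym lg≡lf) (sym h≡) (l<h f)
            , subst (_< h g) (sym h≡) hf<hg ))

    upper-unique : ∀ {e f} → Exceeded e → Exceeded f → page e ≡ page f → h e ≡ h f → e ≡ f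
    upper-unique {e} {f} xe xf p≡ h≡ = span-injective
      (ℕₚ.≤-antisym (ℕₚ.≮⇒≥ (upper-≮ xe (sym p≡) (sym h≡))) (ℕₚ.≮⇒≥ (upper-≮ xf p≡ h≡))) h≡

    -- The Fin 2 component tells charges to lower ends (zero) from charges to upper ends.
    charge : ∀ e → ∃[ v ] Incident G e v × Fin 2
    charge e with exceeded? e | ends e
    ... | no  _ | a , _ , ea , _ = a , ea , zero
    ... | yes _ | _ , b , _ , eb , _ = b , eb , suc zero

    charge-injective : ∀ {e f} → page e ≡ page f → proj₁ (charge e) ≡ proj₁ (charge f) →
                       proj₂ (proj₂ (charge e)) ≡ proj₂ (proj₂ (charge f)) → e ≡ f
    charge-injective {e} {f} p≡ v≡ b≡ with exceeded? e | exceeded? f | ends e | ends f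
    ... | no ¬e | no ¬f | a , _ , _ , _ , la , _ | a′ , _ , _ , _ , la′ , _ =
      lower-unique ¬e ¬f p≡ (trans (sym la) (trans (cong (toℕ ∘ pos) v≡) la′))
    ... | yes xe | yes xf | _ , _ , _ , _ , _ , hb | _ , _ , _ , _ , _ , hb′ =
      upper-unique xe xf p≡ (trans (sym hb) (trans (cong (toℕ ∘ pos) v≡) hb′))
    charge-injective p≡ v≡ () | no _ | yes _ | _ | _
    charge-injective p≡ v≡ () | yes _ | no _ | _ | _

    -- An edge is coded by the vertex charged, the index of its page among the at most `k` pages
    -- there, and the kind of charge. Charges are computed in all of `G`; the vertex charged lies in
    -- `S` because it is an end of the edge.
    edge-bound : ∀ {k} → (∀ v → ∣ LabelsAt G page v ∣ ≤ k) →
                 ∀ S Fs → IsSubgraph G S Fs → ∣ Fs ∣ ≤ ∣ S ∣ ℕ.* k ℕ.* 2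
    edge-bound {k} local S Fs sub = injection⇒∣∣≤ Fs f f-inj
      where
      v∈S : ∀ {e} → e ∈ Fs → proj₁ (charge e) ∈ S
      v∈S {e} e∈ with charge e
      ... | _ , inj₁ refl , _ = proj₁ (sub e e∈)
      ... | _ , inj₂ refl , _ = proj₂ (sub e e∈)

      label : ∀ e → Fin k
      label e = inject≤ (index _ (∈LabelsAt⁺ page (proj₁ (proj₂ (charge e))))) (local (proj₁ (charge e)))

      f : ∀ {e} → e ∈ Fs → Fin (∣ S ∣ ℕ.* k ℕ.* 2)
      f {e} e∈ = combine (combine (index S (v∈S e∈)) (label e)) (proj₂ (proj₂ (charge e)))

      label-inj : ∀ e e′ → proj₁ (charge e) ≡ proj₁ (charge e′) → label e ≡ label e′ → page e ≡ page e′
      label-inj e e′ v≡ eq with charge e | charge e′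
      label-inj e e′ refl eq | v , inc , _ | .v , inc′ , _ =
        index-injective (LabelsAt G page v) _ _ (inject≤-injective (local v) (local v) _ _ eq)

      f-inj : ∀ {e e′} (e∈ : e ∈ Fs) (e′∈ : e′ ∈ Fs) → f e∈ ≡ f e′∈ → e ≡ e′
      f-inj {e} {e′} e∈ e′∈ eq =
        let eq₁ , b≡ = combine-injective _ _ _ _ eq
            s≡ , l≡ = combine-injective _ _ _ _ eq₁
            v≡ = index-injective S (v∈S e∈) (v∈S e′∈) s≡
        in charge-injective (label-inj e e′ v≡ l≡) v≡ b≡

-- Orientations of bounded out-degree

module _ (G : Graph) where
  open Graph G renaming (n to ∣V∣; m to ∣E∣)

  Sparse : ℕ → Set
  Sparse p = ∀ S Fs → IsSubgraph G S Fs → NonZero ∣ S ∣ → ∣ Fs ∣ ≤ ∣ S ∣ ℕ.* p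

  record Orientation (p : ℕ) : Set where
    field
      tail head : Fin ∣E∣ → Fin ∣V∣
      slot      : Fin ∣E∣ → Fin p
      ends      : ∀ e → (src e ≡ tail e × tgt e ≡ head e) ⊎ (src e ≡ head e × tgt e ≡ tail e)
      slot-inj  : ∀ {e f} → tail e ≡ tail f → slot e ≡ slot f → e ≡ f

  -- Orienting becomes bipartite matching: each vertex offers `p` slots, and an edge has its tail at
  -- the end whose slot it receives.
  Slot : ℕ → Set
  Slot p = Fin ∣V∣ × Fin p

  _≟ˢ_ : ∀ {p} (a b : Slot p) → Dec (a ≡ b)
  _≟ˢ_ = ×-≡-dec _≟_ _≟_

  Assignment : ℕ → Set
  Assignment p = Fin ∣E∣ → Slot p

  -- `M` is total but counts only on `D`; unmatching an edge thus means shrinking `D`, with `M` left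
  -- alone.
  record Matches {p} (D : Fin ∣E∣ → Set) (M : Assignment p) : Set where
    field
      incident  : ∀ {e} → D e → Incident G e (proj₁ (M e))
      injective : ∀ {e f} → D e → D f → M e ≡ M f → e ≡ f

  open Matches

  reassign : ∀ {p} {D : Fin ∣E∣ → Set} {M : Assignment p} {x s} →
             Matches (λ e → D e × e ≢ x) M → Incident G x (proj₁ s) →
             (∀ {e} → D e → e ≢ x → M e ≢ s) → Matches D (M [ x ≔ s ])
  reassign {D = D} {M} {x} {s} ok inc fresh = record { incident = inc′ ; injective = inj′ }
    where
    inc′ : ∀ {e} → D e → Incident G e (proj₁ ((M [ x ≔ s ]) e))
    inc′ {e} De with e ≟ x
    ... | yes refl = subst (Incident G x ∘ proj₁) (sym (≔-same M x)) inc
    ... | no e≢x   = subst (Incident G e ∘ proj₁) (sym (≔-other M e≢x)) (incident ok (De , e≢x))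

    inj′ : ∀ {e f} → D e → D f → (M [ x ≔ s ]) e ≡ (M [ x ≔ s ]) f → e ≡ f
    inj′ {e} {f} De Df eq with e ≟ x | f ≟ x
    ... | yes refl | yes refl = refl
    ... | yes refl | no f≢x =
      contradiction (trans (sym (≔-other M f≢x)) (trans (sym eq) (≔-same M x))) (fresh Df f≢x)
    ... | no e≢x | yes refl =
      contradiction (trans (sym (≔-other M e≢x)) (trans eq (≔-same M x))) (fresh De e≢x)
    ... | no e≢x | no f≢x = injective ok (De , e≢x) (Df , f≢x)
      (trans (sym (≔-other M e≢x)) (trans eq (≔-other M f≢x)))

  module _ {p} (sparse : Sparse p) where

    -- Otherwise the p slots at each vertex touched by S all belong to edges of S other
    -- than l, so S has more than p edges per touched vertex.
    free-slot : ∀ {S l} → l ∈ S → (M : Assignment p) →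
                ∃[ x ] ∃[ s ] x ∈ S × Incident G x (proj₁ s) × (∀ {y} → y ∈ S → y ≢ l → M y ≢ s)
    free-slot {S} {l} l∈S M with any? (λ x → any? λ v → any? λ i →
        (x ∈? S) ×-dec incident? G x v ×-dec
        ¬? (any? λ y → (y ∈? S) ×-dec ¬? (y ≟ l) ×-dec (M y ≟ˢ (v , i))))
    ... | yes (x , v , i , x∈S , inc , free) =
      x , (v , i) , x∈S , inc , λ y∈S y≢l eq → free (_ , y∈S , y≢l , eq)
    ... | no none = contradiction (ℕₚ.≤-trans (x∈p⇒∣p-x∣<∣p∣ l∈S) (ℕₚ.≤-trans ∣S∣≤ ≤∣S-l∣)) (ℕₚ.<-irrefl refl)
      where
      touched? : Decidable (λ v → ∃[ x ] x ∈ S × Incident G x v)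
      touched? v = any? λ x → (x ∈? S) ×-dec incident? G x v

      R : Subset ∣V∣
      R = select touched?

      end∈R : ∀ {x v} → x ∈ S → Incident G x v → v ∈ R
      end∈R x∈S inc = ∈select⁺ touched? (_ , x∈S , inc)

      ∣S∣≤ : ∣ S ∣ ≤ ∣ R ∣ ℕ.* p
      ∣S∣≤ = sparse R S (λ x x∈S → end∈R x∈S (inj₁ refl) , end∈R x∈S (inj₂ refl))
        (ℕ.≢-nonZero (ℕₚ.m<n⇒n≢0 (x∈p⇒∣p-x∣<∣p∣ (end∈R l∈S (inj₁ refl)))))

      occupant : ∀ {v} → v ∈ R → ∀ i → ∃[ y ] y ∈ S × y ≢ l × M y ≡ (v , i)
      occupant {v} v∈R i =
        let x , x∈S , inc = ∈select⁻ touched? v∈R in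
        decidable-stable (any? λ y → (y ∈? S) ×-dec ¬? (y ≟ l) ×-dec (M y ≟ˢ (v , i)))
          λ free → none (x , v , i , x∈S , inc , free)

      place : Fin (∣ R ∣ ℕ.* p) → Fin ∣ R ∣ × Fin p
      place = remQuot p

      at : ∀ k → ∃[ y ] y ∈ S × y ≢ l × M y ≡ (proj₁ (element R (proj₁ (place k))) , proj₂ (place k))
      at k = occupant (proj₂ (element R (proj₁ (place k)))) (proj₂ (place k))

      at-inj : ∀ {j k} → proj₁ (at j) ≡ proj₁ (at k) → j ≡ k
      at-inj {j} {k} eq =
        let s≡ = trans (sym (proj₂ (proj₂ (proj₂ (at j))))) (trans (cong M eq) (proj₂ (proj₂ (proj₂ (at k)))))
            r≡ = element-injective R (cong proj₁ s≡)
        in trans (sym (combine-remQuot {∣ R ∣} p j))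
             (trans (cong₂ combine r≡ (cong proj₂ s≡)) (combine-remQuot {∣ R ∣} p k))

      ≤∣S-l∣ : ∣ R ∣ ℕ.* p ≤ ∣ S - l ∣
      ≤∣S-l∣ = injection⇒≤∣∣ (S - l) (proj₁ ∘ at)
        (λ k → let _ , y∈S , y≢l , _ = at k in x∈p∧x≢y⇒x∈p-y y∈S y≢l) at-inj

    module _ {T : Subset ∣E∣} {l : Fin ∣E∣} (l∉T : l ∉ T)
             {M : Assignment p} (M-ok : Matches (_∈ T) M) where

      D : Fin ∣E∣ → Set
      D e = e ∈ T ∪ ⁅ l ⁆

      -- A rearrangement of M along an alternating path from l to x: all edges of D
      -- except x are matched, and only edges of S move.
      record Alternating (S : Subset ∣E∣) (x : Fin ∣E∣) : Set where
        field
          N       : Assignment p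
          matches : Matches (λ e → D e × e ≢ x) N
          outside : ∀ {e} → e ∈ T → e ∉ S → N e ≡ M e
          inside  : ∀ {e} → e ∈ S → e ≢ x → ∃[ y ] y ∈ S × y ≢ l × N e ≡ M y

      old-edge : ∀ {e} → D e → e ≢ l → e ∈ T
      old-edge = ∈-insert⁻

      augment : ∃[ M′ ] Matches D M′
      -- A path is kept to every edge of `S`, since the next free slot may appear at any of them.
      augment = grow {P = λ S → l ∈ S × (∀ {x} → x ∈ S → Alternating S x)} extend ⁅ l ⁆
        (x∈⁅x⁆ l , λ x∈ → subst (Alternating ⁅ l ⁆) (sym (x∈⁅y⁆⇒x≡y l x∈)) start)
        where
        start : Alternating ⁅ l ⁆ l
        start = record
          { N = M
          ; matches = record
            { incident  = λ (De , e≢l) → incident M-ok (old-edge De e≢l)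
            ; injective = λ (De , e≢l) (Df , f≢l) → injective M-ok (old-edge De e≢l) (old-edge Df f≢l) }
          ; outside = λ _ _ → refl
          ; inside  = λ e∈ e≢l → contradiction (x∈⁅y⁆⇒x≡y l e∈) e≢l
          }

        extend : ∀ S → l ∈ S × (∀ {x} → x ∈ S → Alternating S x) →
                 (∃[ M′ ] Matches D M′) ⊎
                 (∃[ y ] y ∉ S × (l ∈ S ∪ ⁅ y ⁆ × (∀ {x} → x ∈ S ∪ ⁅ y ⁆ → Alternating (S ∪ ⁅ y ⁆) x)))
        extend S (l∈S , alt)
          with x , s , x∈S , inc , free ← free-slot l∈S M
          with any? (λ y → (y ∈? T) ×-dec (M y ≟ˢ s))
        ... | no unused = inj₁ (N [ x ≔ s ] , reassign matches inc fresh)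
          where
          open Alternating (alt x∈S)
          -- The slot `s` is known to be free under `M` only. Under `N`, edges of `S` use slots that
          -- `M` gave to edges of `S` other than `l`, and the remaining edges have not moved, so it
          -- is free there as well.
          fresh : ∀ {e} → D e → e ≢ x → N e ≢ s
          fresh {e} De e≢x eq with e ∈? S
          ... | yes e∈S = let y , y∈S , y≢l , N≡M = inside e∈S e≢x in free y∈S y≢l (trans (sym N≡M) eq)
          ... | no  e∉S = let e∈T = old-edge De (λ { refl → e∉S l∈S }) in
            unused (e , e∈T , trans (sym (outside e∈T e∉S)) eq)
        -- `x` takes the slot of `y`, which lies outside `S` and becomes the displaced edge at the
        -- end of a longer path.
        ... | yes (y , y∈T , My≡s) = inj₂ (y , y∉S , ∈-insert-old l∈S , alt′)
          where
          y≢l : y ≢ l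
          y≢l refl = l∉T y∈T

          y∉S : y ∉ S
          y∉S y∈S = free y∈S y≢l My≡s

          widen : ∀ {z} → z ∈ S → Alternating (S ∪ ⁅ y ⁆) z
          widen z∈S = record
            { N = N ; matches = matches
            ; outside = λ e∈T e∉ → outside e∈T (e∉ ∘ ∈-insert-old)
            ; inside  = inside′ }
            where
            open Alternating (alt z∈S)
            inside′ : ∀ {e} → e ∈ S ∪ ⁅ y ⁆ → _ → ∃[ y′ ] y′ ∈ S ∪ ⁅ y ⁆ × y′ ≢ l × N e ≡ M y′
            inside′ {e} e∈ e≢z with e ≟ y
            ... | yes refl = y , ∈-insert-new , y≢l , outside y∈T y∉S
            ... | no e≢y   = let y′ , y′∈S , ok = inside (∈-insert⁻ e∈ e≢y) e≢z in
              y′ , ∈-insert-old y′∈S , ok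

          reach : Alternating (S ∪ ⁅ y ⁆) y
          reach = record
            { N = N [ x ≔ s ]
            ; matches = reassign {D = λ e → D e × e ≢ y} matches′ inc fresh
            ; outside = λ e∈T e∉ → trans (≔-other N λ { refl → e∉ (∈-insert-old x∈S) })
                                         (outside e∈T (e∉ ∘ ∈-insert-old))
            ; inside  = inside′ }
            where
            open Alternating (alt x∈S)
            matches′ : Matches (λ e → (D e × e ≢ y) × e ≢ x) N
            matches′ = record
              { incident  = λ ((De , _) , e≢x) → incident matches (De , e≢x)
              ; injective = λ ((De , _) , e≢x) ((Df , _) , f≢x) → injective matches (De , e≢x) (Df , f≢x) }

            fresh : ∀ {e} → D e × e ≢ y → e ≢ x → N e ≢ s
            fresh {e} (De , e≢y) e≢x eq with e ∈? S
            ... | yes e∈S = let y′ , y′∈S , y′≢l , N≡M = inside e∈S e≢x in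
              free y′∈S y′≢l (trans (sym N≡M) eq)
            ... | no  e∉S = let e∈T = old-edge De (λ { refl → e∉S l∈S }) in
              e≢y (injective M-ok e∈T y∈T (trans (sym (outside e∈T e∉S)) (trans eq (sym My≡s))))

            inside′ : ∀ {e} → e ∈ S ∪ ⁅ y ⁆ → e ≢ y →
                      ∃[ y′ ] y′ ∈ S ∪ ⁅ y ⁆ × y′ ≢ l × (N [ x ≔ s ]) e ≡ M y′
            inside′ {e} e∈ e≢y with e ≟ x
            ... | yes refl = y , ∈-insert-new , y≢l , trans (≔-same N x) (sym My≡s)
            ... | no e≢x   = let y′ , y′∈S , y′≢l , N≡M = inside (∈-insert⁻ e∈ e≢y) e≢x in
              y′ , ∈-insert-old y′∈S , y′≢l , trans (≔-other N e≢x) N≡M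

          alt′ : ∀ {z} → z ∈ S ∪ ⁅ y ⁆ → Alternating (S ∪ ⁅ y ⁆) z
          alt′ {z} z∈ with z ≟ y
          ... | yes refl = reach
          ... | no z≢y   = widen (∈-insert⁻ z∈ z≢y)

    matching : Assignment p → ∃[ M ] Matches (λ _ → Unit.⊤) M
    matching M₀ = grow extend ⊥
      (M₀ , record { incident = λ e∈ → contradiction e∈ ∉⊥ ; injective = λ e∈ → contradiction e∈ ∉⊥ })
      where
      extend : ∀ T → (∃[ M ] Matches (_∈ T) M) →
               (∃[ M ] Matches (λ _ → Unit.⊤) M) ⊎
               (∃[ l ] l ∉ T × (∃[ M ] Matches (_∈ T ∪ ⁅ l ⁆) M))
      extend T (M , ok) with any? (λ l → ¬? (l ∈? T))
      ... | yes (l , l∉T) = inj₂ (l , l∉T , augment l∉T ok)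
      ... | no none = inj₁ (M , record
        { incident  = λ _ → incident ok (all _)
        ; injective = λ _ _ → injective ok (all _) (all _) })
        where
        all : ∀ e → e ∈ T
        all e = decidable-stable (e ∈? T) λ e∉T → none (e , e∉T)

  orient : ∀ {p} → Sparse (suc p) → Orientation (suc p)
  orient sparse = let M , ok = matching sparse (λ e → src e , zero) in record
    { tail = proj₁ ∘ M
    ; head = λ e → proj₁ (other (incident ok {e} _))
    ; slot = proj₂ ∘ M
    ; ends = λ e → proj₂ (other (incident ok {e} _))
    ; slot-inj = λ t≡ s≡ → injective ok _ _ (cong₂ _,_ t≡ s≡)
    }
    where
    other : ∀ {e v} → Incident G e v →
            ∃[ w ] ((src e ≡ v × tgt e ≡ w) ⊎ (src e ≡ w × tgt e ≡ v))
    other {e} (inj₁ s≡) = tgt e , inj₁ (s≡ , refl)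
    other {e} (inj₂ t≡) = src e , inj₂ (refl , t≡)

-- Stars and pages from an orientation

module Oriented (G : Graph) {p} (O : Orientation G p) where
  open Graph G renaming (n to ∣V∣; m to ∣E∣)
  open Orientation O

  tail-inc : ∀ e → Incident G e (tail e)
  tail-inc e with ends e
  ... | inj₁ (s≡ , _) = inj₁ s≡
  ... | inj₂ (_ , t≡) = inj₂ t≡

  head-inc : ∀ e → Incident G e (head e)
  head-inc e with ends e
  ... | inj₁ (_ , t≡) = inj₂ t≡
  ... | inj₂ (s≡ , _) = inj₁ s≡

  end-cases : ∀ {e v} → Incident G e v → v ≡ tail e ⊎ v ≡ head e
  end-cases {e} inc with ends e | inc
  ... | inj₁ (s≡ , t≡) | inj₁ refl = inj₁ s≡
  ... | inj₁ (s≡ , t≡) | inj₂ refl = inj₂ t≡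
  ... | inj₂ (s≡ , t≡) | inj₁ refl = inj₂ s≡
  ... | inj₂ (s≡ , t≡) | inj₂ refl = inj₁ t≡

  tail≢head : ∀ e → tail e ≢ head e
  tail≢head e t≡h with ends e
  ... | inj₁ (s≡ , t≡) = <-irrefl (trans s≡ (trans t≡h (sym t≡))) (src<tgt e)
  ... | inj₂ (s≡ , t≡) = <-irrefl (trans s≡ (trans (sym t≡h) (sym t≡))) (src<tgt e)

  ends-injective : ∀ {e f} → tail e ≡ tail f → head e ≡ head f → e ≡ f
  ends-injective {e} {f} t h with ends e | ends f
  ... | inj₁ (s≡ , t≡) | inj₁ (s′≡ , t′≡) =
    simple e f (trans s≡ (trans t (sym s′≡))) (trans t≡ (trans h (sym t′≡)))
  ... | inj₂ (s≡ , t≡) | inj₂ (s′≡ , t′≡) =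
    simple e f (trans s≡ (trans h (sym s′≡))) (trans t≡ (trans t (sym t′≡)))
  ... | inj₁ (s≡ , t≡) | inj₂ (s′≡ , t′≡) = contradiction (src<tgt f)
    (<-asym (subst₂ (λ x y → toℕ x < toℕ y)
      (trans s≡ (trans t (sym t′≡))) (trans t≡ (trans h (sym s′≡))) (src<tgt e)))
  ... | inj₂ (s≡ , t≡) | inj₁ (s′≡ , t′≡) = contradiction (src<tgt f)
    (<-asym (subst₂ (λ x y → toℕ x < toℕ y)
      (trans s≡ (trans h (sym t′≡))) (trans t≡ (trans t (sym s′≡))) (src<tgt e)))

  -- A vertex meets its own in-star and, through each of its at most `p` out-edges, the in-star at
  -- the other end; the first accounts for the successor.
  localStar : HasLocalStar G (suc p)
  localStar = ∣V∣ , head , id , head-inc , λ v →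
    injection⇒∣∣≤ (LabelsAt G head v) (λ i∈ → place v (∈LabelsAt⁻ G head i∈)) (λ _ _ → place-inj v _ _)
    where
    place : ∀ v {i} → ∃[ e ] Incident G e v × head e ≡ i → Fin (suc p)
    place v (e , _) with head e ≟ v
    ... | yes _ = zero
    ... | no  _ = suc (slot e)

    is-tail : ∀ {e v} → Incident G e v → head e ≢ v → tail e ≡ v
    is-tail inc h≢v with end-cases inc
    ... | inj₁ v≡t = sym v≡t
    ... | inj₂ v≡h = contradiction (sym v≡h) h≢v

    place-inj : ∀ v {i j} (a : ∃[ e ] Incident G e v × head e ≡ i)
                (b : ∃[ e ] Incident G e v × head e ≡ j) →
                place v a ≡ place v b → i ≡ j
    place-inj v (e , inc , refl) (f , inc′ , refl) eq with head e ≟ v | head f ≟ v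
    ... | yes h≡v | yes h′≡v = trans h≡v (sym h′≡v)
    ... | no h≢v | no h′≢v =
      cong head (slot-inj (trans (is-tail inc h≢v) (sym (is-tail inc′ h′≢v))) (suc-injective eq))

  edge-at? : ∀ v i → Dec (∃[ e ] tail e ≡ v × slot e ≡ i)
  edge-at? v i = any? λ e → (tail e ≟ v) ×-dec (slot e ≟ i)

  nb : Arcs ∣V∣ p
  nb v i with edge-at? v i
  ... | yes (e , _) = just (head e)
  ... | no  _       = nothing

  nb-edge : ∀ e → nb (tail e) (slot e) ≡ just (head e)
  nb-edge e with edge-at? (tail e) (slot e)
  ... | yes (f , t≡ , s≡) = cong (just ∘ head) (slot-inj t≡ s≡)
  ... | no  none          = contradiction (e , refl , refl) none

  nb-arc : ∀ {v i w} → nb v i ≡ just w → ∃[ e ] tail e ≡ v × slot e ≡ i × head e ≡ w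
  nb-arc {v} {i} eq with edge-at? v i
  ... | yes (e , t≡ , s≡) = e , t≡ , s≡ , just-injective eq

  nb-simple : Simple nb
  nb-simple = record
    { no-loop = λ v i eq → let e , t≡ , _ , h≡ = nb-arc eq in tail≢head e (trans t≡ (sym h≡))
    ; no-parallel = λ eq eq′ →
        let e , t≡ , s≡ , h≡ = nb-arc eq
            f , t′≡ , s′≡ , h′≡ = nb-arc eq′
        in trans (sym s≡) (trans (cong slot (ends-injective (trans t≡ (sym t′≡)) (trans h≡ (sym h′≡)))) s′≡)
    }

  -- Consecutive edges of a connection cannot meet head to tail, and those that share a tail
  -- coincide. They therefore meet at their heads, so the head is constant along the connection.
  star-component : ∀ {q} {page : Fin ∣E∣ → Fin q} {e f} →
    (∀ {g h} → page g ≡ page e → page h ≡ page e → tail g ≡ tail h → g ≡ h) →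
    (∀ {g h} → page g ≡ page e → page h ≡ page e → head g ≢ tail h) →
    Conn G page e f → head e ≡ head f
  star-component tail-inj head≢tail here = refl
  star-component {page = page} {e} tail-inj head≢tail (step {f} {g} c g≡f (v , vf , vg)) =
    trans (star-component tail-inj head≢tail c) same-head
    where
    f∈ : page f ≡ page e
    f∈ = sym (conn-label G c)
    g∈ : page g ≡ page e
    g∈ = trans g≡f f∈
    same-head : head f ≡ head g
    same-head with end-cases vf | end-cases vg
    ... | inj₁ vt | inj₁ vt′ = cong head (tail-inj f∈ g∈ (trans (sym vt) vt′))
    ... | inj₁ vt | inj₂ vh′ = contradiction (trans (sym vh′) vt) (head≢tail g∈ f∈)
    ... | inj₂ vh | inj₁ vt′ = contradiction (trans (sym vh) vt′) (head≢tail f∈ g∈)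
    ... | inj₂ vh | inj₂ vh′ = trans (sym vh) vh′

module Pages (G : Graph) {p} (O : Orientation G (suc p))
             {u} (split : Decomposition (Oriented.nb G O) ⊤ u) where
  open Graph G renaming (n to ∣V∣; m to ∣E∣)
  open Orientation O
  open Oriented G O
  private module Split = Decomposition split

  col : Fin ∣E∣ → Maybe (Fin (suc p))
  col e = Split.lab (tail e) (slot e)

  tail-inj : ∀ {e f} → col e ≡ col f → tail e ≡ tail f → e ≡ f
  tail-inj {e} {f} c≡ t≡ =
    slot-inj t≡ (Split.lab-inj ∈⊤ (trans c≡ (cong (λ v → Split.lab v (slot f)) (sym t≡))))

  galaxy-head : ∀ {e f} → col e ≡ nothing → col f ≡ nothing → head e ≢ tail f
  galaxy-head {e} {f} e∈ f∈ h≡t with Split.galaxy ∈⊤ e∈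
  ... | w , nb≡ , _ , ok =
    ok (slot f) (trans (cong (λ v → Split.lab v (slot f)) (trans w≡h h≡t)) f∈)
    where w≡h = just-injective (trans (sym nb≡) (nb-edge e))

  module F c = Forest tail head (λ e → ≡-dec _≟_ (col e) (just c)) (Split.rank c)
                      (λ {e} → Split.descend ∈⊤ ∈⊤ (nb-edge e))
                      (λ e∈ f∈ → tail-inj (trans e∈ (sym f∈)))

  module _ (colour : Fin (suc p) → Fin ∣V∣ → Bool)
           (coloured : ∀ c {e} → col e ≡ just c → colour c (tail e) ≡ not (colour c (head e)))
           (posℕ : Fin ∣V∣ → ℕ)
           (uncrossed : ∀ {e f} → col e ≡ just zero → col f ≡ just zero → ¬ Span.Crosses tail head posℕ e f)
           (pos : Fin ∣V∣ → Fin ∣V∣) (ρ : ℕ → ℕ) (pos-inj : Injective _≡_ _≡_ pos) (ρ-mono : Monotone ρ)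
           (pos≡ : ∀ v → toℕ (pos v) ≡ ρ (posℕ v)) where

    open Span tail head posℕ

    lo≡ : ∀ e → lo G pos e ≡ ρ (low e)
    lo≡ e = trans (cong₂ _⊓_ (pos≡ (src e)) (pos≡ (tgt e)))
                  (trans (sym (ℕₚ.mono-≤-distrib-⊓ ρ-mono (posℕ (src e)) (posℕ (tgt e)))) (cong ρ ends-low))
      where
      ends-low : posℕ (src e) ⊓ posℕ (tgt e) ≡ low e
      ends-low with ends e
      ... | inj₁ (s≡ , t≡) = cong₂ _⊓_ (cong posℕ s≡) (cong posℕ t≡)
      ... | inj₂ (s≡ , t≡) = trans (ℕₚ.⊓-comm (posℕ (src e)) _) (cong₂ _⊓_ (cong posℕ t≡) (cong posℕ s≡))

    hi≡ : ∀ e → hi G pos e ≡ ρ (high e)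
    hi≡ e = trans (cong₂ _⊔_ (pos≡ (src e)) (pos≡ (tgt e)))
                  (trans (sym (ℕₚ.mono-≤-distrib-⊔ ρ-mono (posℕ (src e)) (posℕ (tgt e)))) (cong ρ ends-high))
      where
      ends-high : posℕ (src e) ⊔ posℕ (tgt e) ≡ high e
      ends-high with ends e
      ... | inj₁ (s≡ , t≡) = cong₂ _⊔_ (cong posℕ s≡) (cong posℕ t≡)
      ... | inj₂ (s≡ , t≡) = trans (ℕₚ.⊔-comm (posℕ (src e)) _) (cong₂ _⊔_ (cong posℕ t≡) (cong posℕ s≡))

    cross⇒crosses : ∀ {e f} → Cross G pos e f → Crosses e f
    cross⇒crosses {e} {f} cross = crossing-reflect ρ-mono cross′
      where
      cross′ : Crossing (ρ (low e)) (ρ (high e)) (ρ (low f)) (ρ (high f))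
      cross′ rewrite sym (lo≡ e) | sym (hi≡ e) | sym (lo≡ f) | sym (hi≡ f) = cross

    bit : Bool → Fin 2
    bit false = zero
    bit true  = suc zero

    bit-injective : ∀ {a b} → bit a ≡ bit b → a ≡ b
    bit-injective {false} {false} _ = refl
    bit-injective {true}  {true}  _ = refl

    -- One page for the galaxy, one for the forest `zero` drawn whole, and two for each of the other
    -- `p` forests, told apart by the colour of the tail: twice the out-degree bound `suc p`.
    code : Fin ∣V∣ → Maybe (Fin (suc p)) → Fin (2 ℕ.+ p ℕ.* 2)
    code v nothing        = zero
    code v (just zero)    = suc zero
    code v (just (suc j)) = suc (suc (combine j (bit (colour (suc j) v))))

    code-col : ∀ {v w} a b → code v a ≡ code w b → a ≡ b
    code-col nothing        nothing        _  = refl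
    code-col (just zero)    (just zero)    _  = refl
    code-col nothing        (just zero)    ()
    code-col nothing        (just (suc _)) ()
    code-col (just zero)    nothing        ()
    code-col (just (suc _)) nothing        ()
    code-col (just zero)    (just (suc _)) ()
    code-col (just (suc _)) (just zero)    ()
    code-col (just (suc i)) (just (suc j)) eq =
      cong (just ∘ suc) (proj₁ (combine-injective i _ j _ (suc-injective (suc-injective eq))))

    code-colour : ∀ {v w} j → code v (just (suc j)) ≡ code w (just (suc j)) → colour (suc j) v ≡ colour (suc j) w
    code-colour j eq = bit-injective (proj₂ (combine-injective j _ j _ (suc-injective (suc-injective eq))))

    page : Fin ∣E∣ → Fin (2 ℕ.+ p ℕ.* 2)
    page e = code (tail e) (col e)

    page-col : ∀ {e f} → page e ≡ page f → col e ≡ col f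
    page-col {e} {f} = code-col (col e) (col f)

    not-crossed-star : ∀ {e f} → (∀ {g h} → page g ≡ page e → page h ≡ page e → head g ≢ tail h) →
                       Conn G page e f → ¬ Cross G pos e f
    not-crossed-star {e} {f} head≢tail c = share⇒uncrossed G pos {e} {f}
      (head f , subst (Incident G e) (star-component star-tails head≢tail c) (head-inc e) , head-inc f)
      where
      star-tails : ∀ {g h} → page g ≡ page e → page h ≡ page e → tail g ≡ tail h → g ≡ h
      star-tails g∈ h∈ = tail-inj (page-col (trans g∈ (sym h∈)))

    is-union : IsUnion G pos page
    is-union e f c = by-colour (col e) refl
      where
      by-colour : ∀ x → col e ≡ x → ¬ Cross G pos e f
      by-colour nothing e∈ = not-crossed-star
        (λ g∈ h∈ → galaxy-head (trans (page-col g∈) e∈) (trans (page-col h∈) e∈)) c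
      -- The only page on which the vertex order matters; here even edges of different components do
      -- not cross.
      by-colour (just zero) e∈ = uncrossed e∈ f∈ ∘ cross⇒crosses {e} {f}
        where
        f∈ : col f ≡ just zero
        f∈ = trans (sym (page-col (conn-label G c))) e∈
      by-colour (just (suc j)) e∈ = not-crossed-star heads c
        where
        κ = colour (suc j)
        in-class : ∀ {g} → page g ≡ page e → col g ≡ just (suc j)
        in-class g∈ = trans (page-col g∈) e∈
        same-colour : ∀ {g} → page g ≡ page e → κ (tail g) ≡ κ (tail e)
        same-colour {g} g∈ = code-colour j
          (trans (cong (code (tail g)) (sym (in-class g∈))) (trans g∈ (cong (code (tail e)) e∈)))
        heads : ∀ {g h} → page g ≡ page e → page h ≡ page e → head g ≢ tail h
        heads {g} {h} g∈ h∈ h≡t = not-¬ refl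
          (trans (sym (same-colour h∈)) (trans (cong κ (sym h≡t)) (sym (not-swap
            (trans (sym (same-colour g∈)) (coloured (suc j) (in-class g∈)))))))
          where
          not-swap : ∀ {a b} → a ≡ not b → not a ≡ b
          not-swap {b = false} refl = refl
          not-swap {b = true}  refl = refl

    union-of-pages : HasUnion G (2 ℕ.+ p ℕ.* 2)
    union-of-pages = pos , pos-inj , page , is-union

  union-embedding : HasUnion G (2 ℕ.+ p ℕ.* 2)
  union-embedding =
    let posℕ , posℕ-inj , uncrossed = F.1-page zero
        pos , ρ , pos-inj , ρ-mono , pos≡ = order-preserving-compression posℕ posℕ-inj
    in union-of-pages (λ c → proj₁ (F.2-colouring c)) (λ c → proj₂ (F.2-colouring c))
         posℕ uncrossed pos ρ pos-inj ρ-mono pos≡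

-- Densities as fractions

-- `_/_` reduces to lowest terms, so a given numerator and denominator survive only up to
-- equivalence of unnormalised fractions.
toℚᵘ-/ : ∀ a d → ℚ.toℚᵘ (+ a / suc d) ≃ᵘ mkℚᵘ (+ a) d
toℚᵘ-/ a d = ℚₚ.toℚᵘ-fromℚᵘ (mkℚᵘ (+ a) d)

≤ᵘ-fraction : ∀ {a b c d} → a ℕ.* suc d ≤ b ℕ.* suc c → mkℚᵘ (+ a) c ≤ᵘ mkℚᵘ (+ b) d
≤ᵘ-fraction {a} {b} {c} {d} le =
  *≤* (subst₂ ℤ._≤_ (ℤₚ.pos-* a (suc d)) (ℤₚ.pos-* b (suc c)) (ℤ.+≤+ le))

≤ᵘ-fraction⁻ : ∀ {a b c d} → mkℚᵘ (+ a) c ≤ᵘ mkℚᵘ (+ b) d → a ℕ.* suc d ≤ b ℕ.* suc c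
≤ᵘ-fraction⁻ {a} {b} {c} {d} (*≤* le) =
  ℤₚ.drop‿+≤+ (subst₂ ℤ._≤_ (sym (ℤₚ.pos-* a (suc d))) (sym (ℤₚ.pos-* b (suc c))) le)

≤ℚ-from : ∀ {x y a b c d} → ℚ.toℚᵘ x ≃ᵘ mkℚᵘ (+ a) c → ℚ.toℚᵘ y ≃ᵘ mkℚᵘ (+ b) d →
          a ℕ.* suc d ≤ b ℕ.* suc c → x ≤ℚ y
≤ℚ-from x≃ y≃ le = ℚₚ.toℚᵘ-cancel-≤
  (ℚᵘₚ.≤-respˡ-≃ (ℚᵘₚ.≃-sym x≃) (ℚᵘₚ.≤-respʳ-≃ (ℚᵘₚ.≃-sym y≃) (≤ᵘ-fraction le)))

/-≤⁻ : ∀ a b s t .{{_ : NonZero s}} .{{_ : NonZero t}} → (+ a / s) ≤ℚ (+ b / t) → a ℕ.* t ≤ b ℕ.* s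
/-≤⁻ a b (suc c) (suc d) le = ≤ᵘ-fraction⁻ {a} {b}
  (ℚᵘₚ.≤-respˡ-≃ (toℚᵘ-/ a c) (ℚᵘₚ.≤-respʳ-≃ (toℚᵘ-/ b d) (ℚₚ.toℚᵘ-mono-≤ le)))

-- `mkℚᵘ` stores the predecessor of the denominator, and `k + d * suc k` is that of `suc d * suc k`.
toℚᵘ-scale : ∀ a d k → ℚ.toℚᵘ ((+ a / suc d) * (+ 1 / suc k)) ≃ᵘ mkℚᵘ (+ a) (k ℕ.+ d ℕ.* suc k)
toℚᵘ-scale a d k = ℚᵘₚ.≃-trans (ℚₚ.toℚᵘ-homo-* (+ a / suc d) (+ 1 / suc k))
  (ℚᵘₚ.≃-trans (ℚᵘₚ.*-cong (toℚᵘ-/ a d) (toℚᵘ-/ 1 k))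
    (ℚᵘₚ.≃-reflexive (cong (λ z → mkℚᵘ z (k ℕ.+ d ℕ.* suc k)) (ℤₚ.*-identityʳ (+ a)))))

toℚᵘ-+2 : ∀ {x a c} → ℚ.toℚᵘ x ≃ᵘ mkℚᵘ (+ a) c → ℚ.toℚᵘ (x + ℕtoℚ 2) ≃ᵘ mkℚᵘ (+ (a ℕ.+ 2 ℕ.* suc c)) c
toℚᵘ-+2 {x} {a} {c} x≃ = ℚᵘₚ.≃-trans (ℚₚ.toℚᵘ-homo-+ x (ℕtoℚ 2))
  (ℚᵘₚ.≃-trans (ℚᵘₚ.+-cong x≃ (toℚᵘ-/ 2 0)) (ℚᵘₚ.≃-reflexive
    (cong₂ mkℚᵘ (cong₂ ℤ._+_ (ℤₚ.*-identityʳ (+ a)) (sym (ℤₚ.pos-* 2 (suc c)))) (ℕₚ.*-identityʳ c))))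

quarter-≤ : ∀ a s k .{{_ : NonZero s}} → a ≤ k ℕ.* (s ℕ.* 4) → (+ a / s) * (+ 1 / 4) ≤ℚ ℕtoℚ k
quarter-≤ a (suc d) k le = ≤ℚ-from (toℚᵘ-scale a d 3) (toℚᵘ-/ k 0)
  (subst (_≤ k ℕ.* (suc d ℕ.* 4)) (sym (ℕₚ.*-identityʳ a)) le)

≤-half+2 : ∀ a s k .{{_ : NonZero s}} → k ℕ.* (s ℕ.* 2) ≤ a ℕ.+ 2 ℕ.* (s ℕ.* 2) → ℕtoℚ k ≤ℚ (+ a / s) * (+ 1 / 2) + ℕtoℚ 2
≤-half+2 a (suc d) k le = ≤ℚ-from (toℚᵘ-/ k 0) (toℚᵘ-+2 (toℚᵘ-scale a d 1))
  (subst (k ℕ.* (suc d ℕ.* 2) ≤_) (sym (ℕₚ.*-identityʳ (a ℕ.+ 2 ℕ.* (suc d ℕ.* 2)))) le)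

≤-+2 : ∀ a s k .{{_ : NonZero s}} → k ℕ.* s ≤ a ℕ.+ 2 ℕ.* s → ℕtoℚ k ≤ℚ (+ a / s) + ℕtoℚ 2
≤-+2 a (suc d) k le = ≤ℚ-from (toℚᵘ-/ k 0) (toℚᵘ-+2 (toℚᵘ-/ a d))
  (subst (k ℕ.* suc d ≤_) (sym (ℕₚ.*-identityʳ (a ℕ.+ 2 ℕ.* suc d))) le)

-- The 4 is two times two: an edge counts twice in the sum of degrees, and a page at a vertex
-- accounts for up to two charges.
union⇒quarter : ∀ (G : Graph) {pos q} {page : Fin (Graph.m G) → Fin q} {k} →
  (∀ {u v} → pos u ≡ pos v → u ≡ v) → IsUnion G pos page → (∀ v → ∣ LabelsAt G page v ∣ ≤ k) →
  ∀ S Fs (nz : NonZero ∣ S ∣) → IsSubgraph G S Fs → density G S Fs nz * (+ 1 / 4) ≤ℚ ℕtoℚ k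
union⇒quarter G {pos} {page = page} {k} inj union local S Fs nz sub = quarter-≤ (2 ℕ.* ∣ Fs ∣) ∣ S ∣ k {{nz}} (begin
  2 ℕ.* ∣ Fs ∣           ≤⟨ ℕₚ.*-monoʳ-≤ 2 (Charge.edge-bound G pos inj page union local S Fs sub) ⟩
  2 ℕ.* (∣ S ∣ ℕ.* k ℕ.* 2)  ≡⟨ arrange ∣ S ∣ k ⟩
  k ℕ.* (∣ S ∣ ℕ.* 4)      ∎)
  where
  open ℕₚ.≤-Reasoning
  arrange : ∀ s k → 2 ℕ.* (s ℕ.* k ℕ.* 2) ≡ k ℕ.* (s ℕ.* 4)
  arrange = solve-∀

-- Bounds from a densest subgraph

module MaxDensity (G : Graph) {S₀ F₀} (nz : NonZero ∣ S₀ ∣)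
           (max : ∀ S Fs → IsSubgraph G S Fs → (nz′ : NonZero ∣ S ∣) →
                  density G S Fs nz′ ≤ℚ density G S₀ F₀ nz) where

  instance _ = nz

  -- The maximum average degree is `2 f / s`, so `r` is the integer part of its half and `suc r` the
  -- out-degree bound.
  f s r : ℕ
  f = ∣ F₀ ∣
  s = ∣ S₀ ∣
  r = f ℕ./ s

  rs≤f : r ℕ.* s ≤ f
  rs≤f = DivMod.m/n*n≤m f s

  f≤[r+1]s : f ≤ suc r ℕ.* s
  f≤[r+1]s = subst (_≤ suc r ℕ.* s) (sym (DivMod.m≡m%n+[m/n]*n f s)) (ℕₚ.+-monoˡ-≤ (r ℕ.* s) (DivMod.m%n≤n f s))

  sparse : Sparse G (suc r)
  sparse S Fs sub nz′ = ℕₚ.*-cancelˡ-≤ (2 ℕ.* s) {{ℕ.>-nonZero (ℕₚ.*-mono-≤ (s≤s (z≤n {1})) (ℕ.>-nonZero⁻¹ s))}} (begin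
    2 ℕ.* s ℕ.* ∣ Fs ∣             ≡⟨ e₁ s ∣ Fs ∣ ⟩
    2 ℕ.* ∣ Fs ∣ ℕ.* s             ≤⟨ /-≤⁻ (2 ℕ.* ∣ Fs ∣) (2 ℕ.* f) ∣ S ∣ s {{nz′}} (max S Fs sub nz′) ⟩
    2 ℕ.* f ℕ.* ∣ S ∣              ≤⟨ ℕₚ.*-monoˡ-≤ ∣ S ∣ (ℕₚ.*-monoʳ-≤ 2 f≤[r+1]s) ⟩
    2 ℕ.* (suc r ℕ.* s) ℕ.* ∣ S ∣    ≡⟨ e₂ r s ∣ S ∣ ⟩
    2 ℕ.* s ℕ.* (∣ S ∣ ℕ.* suc r)    ∎)
    where
    open ℕₚ.≤-Reasoning
    e₁ : ∀ s x → 2 ℕ.* s ℕ.* x ≡ 2 ℕ.* x ℕ.* s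
    e₁ = solve-∀
    e₂ : ∀ r s x → 2 ℕ.* (suc r ℕ.* s) ℕ.* x ≡ 2 ℕ.* s ℕ.* (x ℕ.* suc r)
    e₂ = solve-∀

  local-bound : ∀ {k} → k ≤ 2 ℕ.+ r → ℕtoℚ k ≤ℚ density G S₀ F₀ nz * (+ 1 / 2) + ℕtoℚ 2
  local-bound {k} k≤ = ≤-half+2 (2 ℕ.* f) s k (begin
    k ℕ.* (s ℕ.* 2)                  ≤⟨ ℕₚ.*-monoˡ-≤ (s ℕ.* 2) k≤ ⟩
    (2 ℕ.+ r) ℕ.* (s ℕ.* 2)          ≡⟨ e r s ⟩
    2 ℕ.* (r ℕ.* s) ℕ.+ 2 ℕ.* (s ℕ.* 2)  ≤⟨ ℕₚ.+-monoˡ-≤ (2 ℕ.* (s ℕ.* 2)) (ℕₚ.*-monoʳ-≤ 2 rs≤f) ⟩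
    2 ℕ.* f ℕ.+ 2 ℕ.* (s ℕ.* 2)        ∎)
    where
    open ℕₚ.≤-Reasoning
    e : ∀ r s → (2 ℕ.+ r) ℕ.* (s ℕ.* 2) ≡ 2 ℕ.* (r ℕ.* s) ℕ.+ 2 ℕ.* (s ℕ.* 2)
    e = solve-∀

  union-bound : ∀ {k} → k ≤ 2 ℕ.+ r ℕ.* 2 → ℕtoℚ k ≤ℚ density G S₀ F₀ nz + ℕtoℚ 2
  union-bound {k} k≤ = ≤-+2 (2 ℕ.* f) s k (begin
    k ℕ.* s                  ≤⟨ ℕₚ.*-monoˡ-≤ s k≤ ⟩
    (2 ℕ.+ r ℕ.* 2) ℕ.* s      ≡⟨ e r s ⟩
    2 ℕ.* (r ℕ.* s) ℕ.+ 2 ℕ.* s  ≤⟨ ℕₚ.+-monoˡ-≤ (2 ℕ.* s) (ℕₚ.*-monoʳ-≤ 2 rs≤f) ⟩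
    2 ℕ.* f ℕ.+ 2 ℕ.* s        ∎)
    where
    open ℕₚ.≤-Reasoning
    e : ∀ r s → (2 ℕ.+ r ℕ.* 2) ℕ.* s ≡ 2 ℕ.* (r ℕ.* s) ℕ.+ 2 ℕ.* s
    e = solve-∀

theorem5 : (G : Graph) → 1 ≤ Graph.n G →
    ∀ {pl pu sl s : ℕ} {q : ℚ} →
    IsPnℓ G pl → IsPnu G pu → IsSaℓ G sl → IsSa G s → IsMad G q →
    (pl ≤ sl) × (pu ≤ s) ×
    ((q * (+ 1 / 4) ≤ℚ ℕtoℚ pl) × (ℕtoℚ pl ≤ℚ q * (+ 1 / 2) + ℕtoℚ 2)) ×
    ((q * (+ 1 / 4) ≤ℚ ℕtoℚ pu) × (ℕtoℚ pu ≤ℚ q + ℕtoℚ 2))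
theorem5 G 1≤n {pl} {pu} {sl} {s} (book , pl-least) (union , pu-least) (star , sl-least) (forests , _)
         (max , S₀ , F₀ , sub , nz , refl) =
  pl≤sl , pu-least s (starForests⇒union G forests) ,
  (lower-local book , local-bound (ℕₚ.≤-trans pl≤sl (sl-least _ (Oriented.localStar G O)))) ,
  -- This bound does not pass through `s`: the forest drawn whole need not be a star forest.
  (lower-union union , union-bound (pu-least _ (Pages.union-embedding G O split)))
  where
  open MaxDensity G {S₀} {F₀} nz max using (r; sparse; local-bound; union-bound)

  pl≤sl : pl ≤ sl
  pl≤sl = pl-least sl (localStar⇒localBook G star)

  O : Orientation G (suc r)
  O = orient G sparse

  -- Any vertex may be the one that `avoids` speaks of; the first exists because the graph is
  -- nonempty.
  split : Decomposition (Oriented.nb G O) ⊤ (fromℕ< 1≤n)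
  split = decompose (Oriented.nb-simple G O) ⊤ _

  lower-local : HasLocalBook G pl → density G S₀ F₀ nz * (+ 1 / 4) ≤ℚ ℕtoℚ pl
  lower-local (pos , inj , _ , page , isBook , local) =
    union⇒quarter G inj (book⇒union G pos isBook) local S₀ F₀ nz sub

  lower-union : HasUnion G pu → density G S₀ F₀ nz * (+ 1 / 4) ≤ℚ ℕtoℚ pu
  lower-union (pos , inj , page , isUnion) =
    union⇒quarter G inj isUnion (λ v → ∣p∣≤n (LabelsAt G page v)) S₀ F₀ nz sub
    where open import Data.Fin.Subset.Properties using (∣p∣≤n)
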